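{- For any sequence of operations on two-parent hollow heaps (as defined and implemented in the context), starting with no heaps, the amortized time per operation is $O(1)$ for each operation other than delete and delete-min, and $O(\log N)$ for each delete or delete-min on a heap of $N$ nodes (full and hollow).
   Context: Heaps. A heap stores a finite set of items, each with a key from a totally ordered universe, and supports: make-heap() (return an empty heap); find-min($h$) (return an item of minimum key in $h$, or null if $h$ is empty); insert($e,k,h$) (add item $e$, which is in no heap, with key $k$); delete-min($h$) (delete from non-empty $h$ the item that find-min($h$) returns); meld($h_1,h_2$) (return a heap containing all items of the item-disjoint heaps $h_1,h_2$); decrease-key($e,k,h$) (given an item $e$ in $h$ with key greater than $k$, change its key to $k$); delete($e,h$) (delete item $e$ from $h$). Heaps passed as arguments are destroyed; decrease-key and delete are given the location of $e$. Nodes. Nodes hold items: each node holds at most one item, and is full if it holds one and hollow otherwise; each item in a heap is held by exactly one node; a newly created node is full and a hollow node never becomes full again. Each node $u$ has a key $u.key$ (the current key of its item if $u$ is full; if $u$ is hollow, the key its item had just before leaving $u$) and a non-negative integer rank $u.rank$. A tree (or dag) of nodes with arcs from parent to child is heap-ordered if $v.key\le w.key$ for every arc $(v,w)$; a root is a node with no parent. For two full roots, link makes the one of larger key (ties broken arbitrarily) a child of the other; the new child is the loser and the other the winner. A ranked link is a link of two roots of equal rank and increases the winner's rank by one; an unranked link may be applied to any two full roots and changes no ranks. Two-parent hollow heap. It is either empty or a heap-ordered directed acyclic graph of nodes with one root, which is full; the root is the minimum node. make-heap returns an empty heap; find-min returns the item in the root; meld returns one heap if the other is empty, and otherwise does an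 unranked link of the two roots; insert($e,k,h$) creates a new full node of rank 0 holding $e$ with key $k$ and melds this one-node heap with $h$. decrease-key($e,k,h$), with $u$ the node holding $e$: if $u$ is the root one may simply set $u.key=k$; otherwise create a new node $v$, move $e$ from $u$ to $v$ (so $u$ becomes hollow), set $v.key=k$ and $v.rank=\max\{0,u.rank-2\}$, add the arc $(v,u)$ so that $u$ acquires $v$ as an additional parent (no children of $u$ are moved), and meld the one-node heap $v$ with the heap. delete($e,h$) removes $e$ from the node $u$ holding it, making $u$ hollow; if $u$ is not the root this completes the operation; otherwise, while some root is hollow, destroy such a root (removing its outgoing arcs, so that children left with no parent become roots); then do ranked links while two roots have equal rank; then do unranked links until one root remains. delete-min($h$) performs delete on the item in the root. Implementation. The children of each node are kept in an exogenous singly-linked list; a link (and the arc added by decrease-key) makes the new child the first child of its parent; each node carries a bit recording whether it has two parents; when a node is destroyed, each of its children whose bit is false becomes a root and each child whose bit is true has it reset to false. During delete, roots of equal rank to be linked are found using an array of roots indexed by rank. -}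

module Defs where

open import Level using () renaming (_⊔_ to _⊔ˡ_)
open import Data.Bool using (Bool; true; false; if_then_else_)
open import Data.Nat using (ℕ; zero; suc; _+_; _*_; _∸_; _≡ᵇ_; _⊔_)
open import Data.Nat.Logarithm using (⌊log₂_⌋)
open import Data.Maybe using (Maybe; just; nothing)
open import Data.List using (List; []; _∷_; _++_; length; foldr)
open import Data.List.Relation.Unary.All using (All)
open import Data.List.Relation.Unary.AllPairs using (AllPairs)
open import Data.List.Relation.Binary.Permutation.Propositional using (_↭_)
open import Data.Product using (∃; _×_; _,_)
open import Relation.Binary.PropositionalEquality using (_≡_; _≢_)
open import Relation.Binary.Bundles using (TotalOrder)
open import Relation.Nullary using (¬_)

-- Two-parent hollow heaps, modelled as a (nondeterministic) transition
-- system with an explicit cost model.  Keys come from an arbitrary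
-- totally ordered universe O.  Nodes and heaps are named by natural
-- numbers (freshly allocated from counters).  An item is identified with
-- (the location of) the node currently holding it.

module HollowHeap {a ℓ₁ ℓ₂} (O : TotalOrder a ℓ₁ ℓ₂) where

  open TotalOrder O using (_≤_) renaming (Carrier to Key)

  NodeId : Set
  NodeId = ℕ

  HeapId : Set
  HeapId = ℕ

  record Node : Set a where
    field
      full     : Bool
      key      : Key
      rank     : ℕ
      children : List NodeId  -- exogenous singly-linked child list
      two      : Bool         -- the "has two parents" bit
      label    : HeapId       -- ghost: heap the node belongs to (no cost)
  open Node public

  -- the store of all live nodes (destroyed / unallocated ids map to nothing)
  NodeMap : Set a
  NodeMap = NodeId → Maybe Node

  upd : ∀ {b} {A : Set b} → (ℕ → A) → ℕ → A → (ℕ → A)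
  upd f i x j = if j ≡ᵇ i then x else f j

  -- a heap is absent (nothing), empty (just nothing) or has a root
  record State : Set a where
    field
      nodes    : NodeMap
      heaps    : HeapId → Maybe (Maybe NodeId)
      nextNode : ℕ
      nextHeap : ℕ
  open State public

  initial : State
  initial = record { nodes = λ _ → nothing ; heaps = λ _ → nothing
                   ; nextNode = 0 ; nextHeap = 0 }

  countIn : NodeMap → HeapId → ℕ → ℕ
  countIn M h zero = 0
  countIn M h (suc n) = countIn M h n + one (M n)
    where
      one : Maybe Node → ℕ
      one nothing = 0
      one (just x) = if label x ≡ᵇ h then 1 else 0

  size : State → HeapId → ℕ
  size s h = countIn (nodes s) h (nextNode s)

  addChild : NodeId → Node → Node
  addChild l W = record W { children = l ∷ children W }

  incRank : Node → Node
  incRank W = record W { rank = suc (rank W) }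

  data Link (M : NodeMap) (w l : NodeId) : NodeMap → Set (a ⊔ˡ ℓ₂) where
    link : ∀ {W L} → M w ≡ just W → M l ≡ just L →
           full W ≡ true → full L ≡ true → key W ≤ key L →
           Link M w l (upd M w (just (addChild l W)))

  data RLink (M : NodeMap) (w l : NodeId) : NodeMap → Set (a ⊔ˡ ℓ₂) where
    rlink : ∀ {W L} → M w ≡ just W → M l ≡ just L →
            full W ≡ true → full L ≡ true → key W ≤ key L →
            rank W ≡ rank L →
            RLink M w l (upd M w (just (addChild l (incRank W))))

  data MeldRoots (M : NodeMap) : Maybe NodeId → Maybe NodeId →
                                 NodeMap → Maybe NodeId → Set (a ⊔ˡ ℓ₂) where
    leftEmpty  : ∀ {m} → MeldRoots M nothing m M m
    rightEmpty : ∀ {r} → MeldRoots M (just r) nothing M (just r)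
    linkL : ∀ {r₁ r₂ M'} → Link M r₁ r₂ M' → MeldRoots M (just r₁) (just r₂) M' (just r₁)
    linkR : ∀ {r₁ r₂ M'} → Link M r₂ r₁ M' → MeldRoots M (just r₁) (just r₂) M' (just r₂)

  IsFull : NodeMap → NodeId → Set a
  IsFull M r = ∃ λ x → M r ≡ just x × full x ≡ true

  processChildren : NodeMap → List NodeId → NodeMap × List NodeId
  processChildren M [] = M , []
  processChildren M (c ∷ cs) with processChildren M cs
  ... | M₁ , R₁ with M₁ c
  ...   | nothing = M₁ , R₁
  ...   | just x  = if two x then (upd M₁ c (just (record x { two = false })) , R₁)
                             else (M₁ , c ∷ R₁)

  data Destroy : NodeMap → List NodeId → NodeMap → List NodeId → ℕ → Set a where
    stop : ∀ {M R} → All (IsFull M) R → Destroy M R M R 0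
    kill : ∀ {M R M' R' c} xs r ys x →
           R ≡ xs ++ r ∷ ys → M r ≡ just x → full x ≡ false →
           (let P = processChildren (upd M r nothing) (children x)
            in Destroy (Data.Product.proj₁ P) (xs ++ ys ++ Data.Product.proj₂ P) M' R' c) →
           Destroy M R M' R' (suc (length (children x) + c))

  DistinctRank : NodeMap → NodeId → NodeId → Set a
  DistinctRank M p q = ∀ x y → M p ≡ just x → M q ≡ just y → rank x ≢ rank y

  data RankedLinks : NodeMap → List NodeId → NodeMap → List NodeId → ℕ → Set (a ⊔ˡ ℓ₂) where
    stop : ∀ {M R} → AllPairs (DistinctRank M) R → RankedLinks M R M R 0
    step : ∀ {M R M₁ M' R' c} w l Rest →
           R ↭ w ∷ l ∷ Rest → RLink M w l M₁ →
           RankedLinks M₁ (w ∷ Rest) M' R' c → RankedLinks M R M' R' (suc c)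

  data UnrankedLinks : NodeMap → List NodeId → NodeMap → Maybe NodeId → ℕ → Set (a ⊔ˡ ℓ₂) where
    none : ∀ {M} → UnrankedLinks M [] M nothing 0
    one  : ∀ {M r} → UnrankedLinks M (r ∷ []) M (just r) 0
    step : ∀ {M R M₁ M' res c} w l Rest →
           R ↭ w ∷ l ∷ Rest → Link M w l M₁ →
           UnrankedLinks M₁ (w ∷ Rest) M' res c → UnrankedLinks M R M' res (suc c)

  maxRank : NodeMap → List NodeId → ℕ
  maxRank M = foldr (λ r m → rk (M r) ⊔ m) 0
    where
      rk : Maybe Node → ℕ
      rk nothing = 0
      rk (just x) = rank x

  -- delete the item of root r.  Cost: 1 + phase costs + size of the
  -- rank-indexed array scanned (1 + maximum root rank after phase 2).
  data DeleteRoot (M : NodeMap) (r : NodeId) : NodeMap → Maybe NodeId → ℕ → Set (a ⊔ˡ ℓ₂) where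
    del : ∀ {X M₁ R₁ c₁ M₂ R₂ c₂ M₃ res c₃} →
          M r ≡ just X →
          Destroy (upd M r (just (record X { full = false }))) (r ∷ []) M₁ R₁ c₁ →
          RankedLinks M₁ R₁ M₂ R₂ c₂ →
          UnrankedLinks M₂ R₂ M₃ res c₃ →
          DeleteRoot M r M₃ res (suc (c₁ + c₂ + suc (maxRank M₂ R₂) + c₃))

  data Op : Set a where
    makeHeap    : Op
    findMin     : HeapId → Op
    insert      : Key → HeapId → Op
    meld        : HeapId → HeapId → Op
    decreaseKey : NodeId → Key → HeapId → Op    -- node = location of the item
    delete      : NodeId → HeapId → Op
    deleteMin   : HeapId → Op

  relabel : NodeMap → HeapId → HeapId → NodeMap
  relabel M h₂ h₁ i with M i
  ... | nothing = nothing
  ... | just x  = just (if label x ≡ᵇ h₂ then record x { label = h₁ } else x)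

  -- Step s o s' c : operation o on state s may result in s' at actual cost c
  data Step (s : State) : Op → State → ℕ → Set (a ⊔ˡ ℓ₂) where
    makeHeapS : Step s makeHeap
      (record s { heaps = upd (heaps s) (nextHeap s) (just nothing)
                ; nextHeap = suc (nextHeap s) }) 1
    findMinS : ∀ {h m} → heaps s h ≡ just m → Step s (findMin h) s 1
    insertS : ∀ {k h m M' m'} → heaps s h ≡ just m →
      MeldRoots (upd (nodes s) (nextNode s)
                  (just (record { full = true ; key = k ; rank = 0 ; children = []
                                ; two = false ; label = h })))
                m (just (nextNode s)) M' m' →
      Step s (insert k h)
        (record s { nodes = M' ; heaps = upd (heaps s) h (just m')
                  ; nextNode = suc (nextNode s) }) 1
    meldS : ∀ {h₁ h₂ m₁ m₂ M' m} → h₁ ≢ h₂ →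
      heaps s h₁ ≡ just m₁ → heaps s h₂ ≡ just m₂ →
      MeldRoots (relabel (nodes s) h₂ h₁) m₁ m₂ M' m →
      Step s (meld h₁ h₂)
        (record s { nodes = M' ; heaps = upd (upd (heaps s) h₂ nothing) h₁ (just m) }) 1
    decreaseKeyRootS : ∀ {u k h U} → heaps s h ≡ just (just u) →
      nodes s u ≡ just U → full U ≡ true → label U ≡ h → ¬ (key U ≤ k) →
      Step s (decreaseKey u k h)
        (record s { nodes = upd (nodes s) u (just (record U { key = k })) }) 1
    decreaseKeyS : ∀ {u k h r U M' m} → heaps s h ≡ just (just r) → u ≢ r →
      nodes s u ≡ just U → full U ≡ true → label U ≡ h → ¬ (key U ≤ k) →
      MeldRoots (upd (upd (nodes s) u (just (record U { full = false ; two = true })))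
                     (nextNode s)
                     (just (record { full = true ; key = k ; rank = rank U ∸ 2
                                   ; children = u ∷ [] ; two = false ; label = h })))
                (just r) (just (nextNode s)) M' m →
      Step s (decreaseKey u k h)
        (record s { nodes = M' ; heaps = upd (heaps s) h (just m)
                  ; nextNode = suc (nextNode s) }) 1
    deleteS : ∀ {u h r U} → heaps s h ≡ just (just r) → u ≢ r →
      nodes s u ≡ just U → full U ≡ true → label U ≡ h →
      Step s (delete u h)
        (record s { nodes = upd (nodes s) u (just (record U { full = false })) }) 1
    deleteRootS : ∀ {u h U M' res c} → heaps s h ≡ just (just u) →
      nodes s u ≡ just U → full U ≡ true → label U ≡ h →
      DeleteRoot (nodes s) u M' res c →
      Step s (delete u h)
        (record s { nodes = M' ; heaps = upd (heaps s) h (just res) }) c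
    deleteMinS : ∀ {h r M' res c} → heaps s h ≡ just (just r) →
      DeleteRoot (nodes s) r M' res c →
      Step s (deleteMin h)
        (record s { nodes = M' ; heaps = upd (heaps s) h (just res) }) c

  -- the claimed amortized bound of an operation (up to the constant):
  -- 1 + log N for delete / delete-min on a heap of N nodes, 1 otherwise
  allowance : State → Op → ℕ
  allowance s (delete u h)  = suc ⌊log₂ size s h ⌋
  allowance s (deleteMin h) = suc ⌊log₂ size s h ⌋
  allowance s _             = 1

  data Exec : State → ℕ → ℕ → Set (a ⊔ˡ ℓ₂) where
    done : ∀ {s} → Exec s 0 0
    step : ∀ {s o s' c C A} → Step s o s' c → Exec s' C A →
           Exec s (c + C) (allowance s o + A)

{-# OPTIONS --safe #-}
module Submission where

-- The potential of a state is three units per node and one per arc, minus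
-- twice the sum of the ranks of the full nodes.  Destroying a hollow node is
-- paid for by the node and its outgoing arcs.  A ranked link adds an arc but
-- raises the rank of a full node, so it also pays for itself.  Decrease-key
-- loses u.rank - v.rank ≤ 2 of the rank sum, and delete loses one rank.
--
-- Nonnegativity of the potential and the logarithmic bound on ranks both come
-- from a virtual forest: a full node of rank r has virtual children of ranks
-- r - 1, …, 0, a hollow one at least those of the two highest ranks, all of
-- them are proper descendants in the dag, and no node has two virtual parents.
-- Hence the rank sum of full nodes is at most the number of nodes, and the two
-- top virtual subtrees of a node are disjoint, so that a node of rank at least
-- 2k lies in a heap with at least 2^k nodes.

open import Defs
open import Data.Bool using (true; false; if_then_else_)
open import Data.Bool.Properties using (T-≡)
open import Data.Empty using (⊥-elim)
open import Data.List using (List; []; _∷_; _++_; length; map; take; drop)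
open import Data.List.Properties using (length-map; length-++; ++-assoc)
open import Data.List.Membership.Propositional using (_∈_; _∉_)
open import Data.List.Membership.Propositional.Properties using (∈-++⁻)
open import Data.List.Relation.Binary.Permutation.Propositional using (_↭_; ↭⇒↭ₛ)
open import Data.List.Relation.Binary.Permutation.Propositional.Properties using (shift; All-resp-↭; ↭-length)
import Data.List.Relation.Binary.Permutation.Setoid.Properties as PermSetoid
open import Data.List.Relation.Unary.All using (All; []; _∷_)
import Data.List.Relation.Unary.All as All
import Data.List.Relation.Unary.All.Properties as AllP
open import Data.List.Relation.Unary.AllPairs using (AllPairs; []; _∷_)
open import Data.List.Relation.Unary.Any using (here; there)
open import Data.List.Relation.Unary.Unique.Propositional using (Unique)
import Data.List.Relation.Unary.Unique.Propositional.Properties as UniqueP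
open import Data.Maybe using (Maybe; just; nothing; maybe′)
import Data.Maybe as Maybe
open import Data.Maybe.Properties using (just-injective)
open import Data.Nat using (ℕ; zero; suc; pred; _+_; _*_; _∸_; _^_; _≤_; _<_; z≤n; s≤s; _≡ᵇ_; _⊔_)
open import Data.Nat.Logarithm using (⌊log₂_⌋; ⌊log₂⌋-mono-≤; ⌊log₂[2^n]⌋≡n)
open import Data.Nat.Properties
open import Data.Nat.Tactic.RingSolver using (solve-∀)
open import Data.Product using (∃; _×_; _,_; proj₁; proj₂)
open import Data.Sum using (_⊎_; inj₁; inj₂)
open import Function using (_∘_; id; Equivalence)
open import Relation.Binary.Bundles using (TotalOrder)
open import Relation.Binary.Construct.Closure.Transitive using (TransClosure; [_]; _∷_)
open import Relation.Binary.PropositionalEquality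
  using (_≡_; _≢_; refl; sym; trans; cong; cong₂; subst; subst₂; setoid; module ≡-Reasoning)
open import Relation.Nullary using (¬_; yes; no)

-- Decrease-key moves no children, so arcs alone say little about ranks: the new node starts with
-- the single child `u`, whatever its rank, and `u` keeps all its arcs. The bookkeeping is therefore
-- detached from the arcs: the lists `V` exist in the analysis only, and a mere path ties a virtual
-- child to its virtual parent. When the list of `u` is split, the part handed to the new node is
-- still reachable, through `u`. Conversely, a virtual child always has a parent, so a root occurs
-- in no list; since only roots are destroyed, linked or raised in rank, these steps never
-- invalidate the list of another node. The weight 2 of the rank sum is what a ranked link consumes:
-- one unit for its time and one for the arc that it adds. A rank drop of at most 2 thus costs
-- decrease-key 4 units; with 4 for the new node and its arc and 2 for the meld this makes the
-- constant 10, which also suffices for a root deletion.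

Unique-resp-↭ : ∀ {xs ys : List ℕ} → xs ↭ ys → Unique xs → Unique ys
Unique-resp-↭ p = PermSetoid.Unique-resp-↭ (setoid ℕ) (↭⇒↭ₛ p)

take2∩drop2⊆∅ : ∀ {c} (l : List ℕ) → Unique l → c ∈ take 2 l → c ∉ drop 2 l
take2∩drop2⊆∅ (x ∷ y ∷ l) ((_ ∷ x∉) ∷ _) (here refl) c∈         = All.lookup x∉ c∈ refl
take2∩drop2⊆∅ (x ∷ y ∷ l) (_ ∷ y∉ ∷ _) (there (here refl)) c∈   = All.lookup y∉ c∈ refl

take2⊆ : ∀ {c} (l : List ℕ) → c ∈ take 2 l → c ∈ l
take2⊆ (x ∷ l)     (here e)         = here e
take2⊆ (x ∷ y ∷ l) (there (here e)) = there (here e)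

drop2⊆ : ∀ {c} (l : List ℕ) → c ∈ drop 2 l → c ∈ l
drop2⊆ (x ∷ y ∷ l) c∈ = there (there c∈)

-- Sums over an initial segment of the naturals

sumTo : (ℕ → ℕ) → ℕ → ℕ
sumTo g zero    = 0
sumTo g (suc n) = sumTo g n + g n

sumTo-cong : ∀ {g g′} n → (∀ i → i < n → g i ≡ g′ i) → sumTo g n ≡ sumTo g′ n
sumTo-cong zero    e = refl
sumTo-cong (suc n) e = cong₂ _+_ (sumTo-cong n λ i i<n → e i (m<n⇒m<1+n i<n)) (e n ≤-refl)

sumTo-one : ∀ n → sumTo (λ _ → 1) n ≡ n
sumTo-one zero    = refl
sumTo-one (suc n) = trans (cong (_+ 1) (sumTo-one n)) (+-comm n 1)

-- Only the term at `r` changes. Each side adds the term that the other sum contains, which avoids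
-- truncated subtraction.
sumTo-point : ∀ {g g′} r n → r < n → (∀ i → i ≢ r → g′ i ≡ g i) →
              sumTo g′ n + g r ≡ sumTo g n + g′ r
sumTo-point {g} {g′} r (suc n) r<n off with r ≟ n
... | yes refl rewrite sumTo-cong {g′} {g} n (λ i i<n → off i (<⇒≢ i<n)) =
  lemma (sumTo g n) (g′ n) (g n)
  where
    lemma : ∀ x y z → x + y + z ≡ x + z + y
    lemma = solve-∀
... | no r≢n rewrite off n (r≢n ∘ sym) = begin
    sumTo g′ n + g n + g r ≡⟨ lemma (sumTo g′ n) (g n) (g r) ⟩
    sumTo g′ n + g r + g n ≡⟨ cong (_+ g n) (sumTo-point r n (≤∧≢⇒< (≤-pred r<n) r≢n) off) ⟩
    sumTo g n + g′ r + g n ≡⟨ lemma (sumTo g n) (g′ r) (g n) ⟩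
    sumTo g n + g n + g′ r ∎
  where
    open ≡-Reasoning
    lemma : ∀ x y z → x + y + z ≡ x + z + y
    lemma = solve-∀

-- Induction on the list: setting `g` to 0 at the head takes at least `k` out of the sum, and
-- uniqueness keeps the bound intact on the tail.
weighted-length≤sumTo : ∀ k {g} l n → Unique l → All (λ i → i < n × k ≤ g i) l →
                        length l * k ≤ sumTo g n
weighted-length≤sumTo k []      n _ _ = z≤n
weighted-length≤sumTo k {g} (x ∷ l) n (x∉l ∷ uniq) ((x<n , k≤gx) ∷ bound) = begin
    k + length l * k        ≡⟨ +-comm k _ ⟩
    length l * k + k        ≤⟨ +-mono-≤ (weighted-length≤sumTo k l n uniq bound′) k≤gx ⟩
    sumTo g′ n + g x        ≡⟨ sumTo-point x n x<n off ⟩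
    sumTo g n + g′ x        ≡⟨ cong (sumTo g n +_) at ⟩
    sumTo g n + 0           ≡⟨ +-identityʳ _ ⟩
    sumTo g n               ∎
  where
    open ≤-Reasoning
    g′ : ℕ → ℕ
    g′ i with i ≟ x
    ... | yes _ = 0
    ... | no  _ = g i
    off : ∀ i → i ≢ x → g′ i ≡ g i
    off i i≢x with i ≟ x
    ... | yes p = ⊥-elim (i≢x p)
    ... | no  _ = refl
    at : g′ x ≡ 0
    at with x ≟ x
    ... | yes _ = refl
    ... | no  p = ⊥-elim (p refl)
    bound′ : All (λ i → i < n × k ≤ g′ i) l
    bound′ = All.zipWith (λ { {i} (x≢i , i<n , le) → i<n , subst (k ≤_) (sym (off i (x≢i ∘ sym))) le })
                         (x∉l , bound)

length≤sumTo : ∀ {g} l n → Unique l → All (λ i → i < n × 1 ≤ g i) l → length l ≤ sumTo g n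
length≤sumTo l n uniq bound =
  subst (_≤ _) (*-identityʳ (length l)) (weighted-length≤sumTo 1 l n uniq bound)

≡ᵇ-refl : ∀ n → (n ≡ᵇ n) ≡ true
≡ᵇ-refl n = Equivalence.to T-≡ (≡⇒≡ᵇ n n refl)

≢⇒≡ᵇ-false : ∀ {m n} → m ≢ n → (m ≡ᵇ n) ≡ false
≢⇒≡ᵇ-false {m} {n} m≢n with m ≡ᵇ n in eq
... | true  = ⊥-elim (m≢n (≡ᵇ⇒≡ m n (Equivalence.from T-≡ eq)))
... | false = refl

-- Structural invariant

module Analysis {a ℓ₁ ℓ₂} (O : TotalOrder a ℓ₁ ℓ₂) where

  open HollowHeap O

  upd-at : ∀ {b} {A : Set b} (f : ℕ → A) i x → upd f i x i ≡ x
  upd-at f i x rewrite ≡ᵇ-refl i = refl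

  upd-off : ∀ {b} {A : Set b} (f : ℕ → A) i x {j} → j ≢ i → upd f i x j ≡ f j
  upd-off f i x j≢i rewrite ≢⇒≡ᵇ-false j≢i = refl

  -- A pointwise description instead of an equation with `upd`: two successive updates at one node
  -- and a single one agree only pointwise, and both have to fit.
  record PointUpdate (M : NodeMap) (r : NodeId) (v : Maybe Node) (M′ : NodeMap) : Set a where
    constructor point
    field
      at  : M′ r ≡ v
      off : ∀ {i} → i ≢ r → M′ i ≡ M i

  upd-point : ∀ M r v → PointUpdate M r v (upd M r v)
  upd-point M r v = point (upd-at M r v) (upd-off M r v)

  Arc : NodeMap → NodeId → NodeId → Set a
  Arc M p c = ∃ λ x → M p ≡ just x × c ∈ children x

  Below : NodeMap → NodeId → NodeId → Set a
  Below M = TransClosure (Arc M)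

  NoParent SoleParent : NodeMap → NodeId → Set a
  NoParent M c   = ∀ {p} → ¬ Arc M p c
  SoleParent M c = ∀ {p q} → Arc M p c → Arc M q c → p ≡ q

  below⇒¬noParent : ∀ {M u c} → Below M u c → ¬ NoParent M c
  below⇒¬noParent [ arc ]    np = np arc
  below⇒¬noParent (_ ∷ path) np = below⇒¬noParent path np

  below-map : ∀ {M M′ u c} → (∀ {p q} → Arc M p q → Arc M′ p q) → Below M u c → Below M′ u c
  below-map f [ arc ]      = [ f arc ]
  below-map f (arc ∷ path) = f arc ∷ below-map f path

  RankIs : NodeMap → ℕ → NodeId → Set a
  RankIs M r c = ∃ λ y → M c ≡ just y × rank y ≡ r

  -- Ranked M k r l: the nodes of l have ranks r - 1, r - 2, …; the list may
  -- stop before rank 0, but only after at least k entries.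
  data Ranked (M : NodeMap) : ℕ → ℕ → List NodeId → Set a where
    nil  : ∀ {k} → Ranked M k 0 []
    cut  : ∀ {r} → Ranked M 0 r []
    cons : ∀ {k r c l} → RankIs M r c → Ranked M (pred k) r l → Ranked M k (suc r) (c ∷ l)

  -- With demand equal to the rank the list cannot stop early, because `cut` then forces both to be
  -- 0. A complete list meets every demand.
  ranked-weaken : ∀ {M r k l} → Ranked M r r l → Ranked M k r l
  ranked-weaken nil        = nil
  ranked-weaken cut        = nil
  ranked-weaken (cons c p) = cons c (ranked-weaken p)

  ranked-take2 : ∀ {M r l} → Ranked M r r l → Ranked M 2 r (take 2 l)
  ranked-take2 nil                 = nil
  ranked-take2 cut                 = nil
  ranked-take2 (cons c nil)        = cons c nil
  ranked-take2 (cons c cut)        = cons c nil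
  ranked-take2 (cons c (cons d _)) = cons c (cons d cut)

  -- The entries after the first two have ranks `r - 3`, ..., 0. This is exactly the complete list
  -- required of a full node of rank `r ∸ 2`, the rank that decrease-key gives to its new node.
  ranked-drop2 : ∀ {M r l} → Ranked M r r l → Ranked M (r ∸ 2) (r ∸ 2) (drop 2 l)
  ranked-drop2 nil                 = nil
  ranked-drop2 cut                 = nil
  ranked-drop2 (cons c nil)        = nil
  ranked-drop2 (cons c cut)        = nil
  ranked-drop2 (cons c (cons d p)) = p

  ranked-length : ∀ {M r l} → Ranked M r r l → length l ≡ r
  ranked-length nil        = refl
  ranked-length cut        = refl
  ranked-length (cons _ p) = cong suc (ranked-length p)

  ranked-< : ∀ {M k r l c} → Ranked M k r l → c ∈ l → ∃ λ y → M c ≡ just y × rank y < r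
  ranked-< (cons (y , e , refl) _) (here refl) = y , e , ≤-refl
  ranked-< (cons _ p) (there c∈l) with ranked-< p c∈l
  ... | y , e , lt = y , e , m<n⇒m<1+n lt

  -- Ranks strictly decrease along the list, so a repeated entry would have two ranks.
  ranked-unique : ∀ {M k r l} → Ranked M k r l → Unique l
  ranked-unique nil = []
  ranked-unique cut = []
  ranked-unique {M} {l = c ∷ l} (cons {r = r} (y , e , refl) p) = All.tabulate differs ∷ ranked-unique p
    where
      differs : ∀ {d} → d ∈ l → c ≢ d
      differs d∈l refl with ranked-< p d∈l
      ... | z , e′ , lt with trans (sym e) e′
      ... | refl = <-irrefl refl lt

  ranked-map : ∀ {M M′ k r l} → (∀ {c r} → c ∈ l → RankIs M r c → RankIs M′ r c) →
               Ranked M k r l → Ranked M′ k r l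
  ranked-map f nil        = nil
  ranked-map f cut        = cut
  ranked-map f (cons c p) = cons (f (here refl) c) (ranked-map (f ∘ there) p)

  ranked-topTwo : ∀ {M k r l} → Ranked M (2 + k) (2 + r) l →
    ∃ λ c → ∃ λ d → c ∈ l × d ∈ l × RankIs M (suc r) c × RankIs M r d
  ranked-topTwo (cons c (cons d _)) = _ , _ , here refl , there (here refl) , c , d

  -- A hollow node of rank below 2 causes no conflict: `nil` ends a complete list under any demand.
  demand : Node → ℕ
  demand x = if full x then rank x else 2

  -- V u lists the virtual children of u.  A ranked link makes the loser a
  -- virtual child of the winner; decrease-key leaves the two virtual children
  -- of highest rank with the old node and hands the others to the new node.
  record Inv (M : NodeMap) (n : ℕ) (V : NodeId → List NodeId) : Set a where
    field
      bounded    : ∀ {i x} → M i ≡ just x → i < n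
      labelled   : ∀ {p x c} → M p ≡ just x → c ∈ children x → ∃ λ y → M c ≡ just y × label y ≡ label x
      distinct   : ∀ {p x} → M p ≡ just x → Unique (children x)
      single     : ∀ {c y} → M c ≡ just y → two y ≡ false → SoleParent M c
      double     : ∀ {p q t c} → Arc M p c → Arc M q c → Arc M t c → p ≡ q ⊎ q ≡ t ⊎ p ≡ t
      fullSingle : ∀ {c y} → M c ≡ just y → full y ≡ true → two y ≡ false
      ranked     : ∀ {u x} → M u ≡ just x → Ranked M (demand x) (rank x) (V u)
      below      : ∀ {u x c} → M u ≡ just x → c ∈ V u → Below M u c
      disjoint   : ∀ {u v x y c} → M u ≡ just x → M v ≡ just y → c ∈ V u → c ∈ V v → u ≡ v

    fresh : M n ≡ nothing
    fresh with M n in eq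
    ... | nothing = refl
    ... | just x  = ⊥-elim (<-irrefl refl (bounded eq))

    live-child : ∀ {p c} → Arc M p c → ∃ λ y → M c ≡ just y
    live-child (x , e , c∈) with labelled e c∈
    ... | y , e′ , _ = y , e′

    fresh-noParent : NoParent M n
    fresh-noParent arc with live-child arc
    ... | y , e with trans (sym fresh) e
    ... | ()

    root∉virtual : ∀ {c u x} → NoParent M c → M u ≡ just x → c ∉ V u
    root∉virtual np e c∈ = below⇒¬noParent (below e c∈) np

    fullRanked : ∀ {u x} → M u ≡ just x → full x ≡ true → Ranked M (rank x) (rank x) (V u)
    fullRanked {u} {x} e f with ranked e
    ... | p rewrite f = p

  -- Preservation of the invariant under changes of the node map

  rankIs-functional : ∀ {M r s c} → RankIs M r c → RankIs M s c → r ≡ s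
  rankIs-functional (y , e , refl) (z , e′ , refl) with trans (sym e) e′
  ... | refl = refl

  map-just : ∀ {φ : Node → Node} {v x} → v ≡ just x → Maybe.map φ v ≡ just (φ x)
  map-just refl = refl

  map-just⁻ : ∀ {φ : Node → Node} v {x′} → Maybe.map φ v ≡ just x′ →
              ∃ λ x → v ≡ just x × x′ ≡ φ x
  map-just⁻ (just x) refl = x , refl , refl

  -- Covers every change that leaves live ids, arcs and ranks alone. Labels need only stay equal
  -- where they were equal, since meld renames them, and the lists may shrink, as that of the old
  -- node does under decrease-key.
  inv-map : ∀ {M M′ n V V′} → Inv M n V → (φ : NodeId → Node → Node) →
    (∀ i → M′ i ≡ Maybe.map (φ i) (M i)) →
    (∀ i {x} → M i ≡ just x → children (φ i x) ≡ children x) →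
    (∀ i {x} → M i ≡ just x → rank (φ i x) ≡ rank x) →
    (∀ i j {x y} → M i ≡ just x → M j ≡ just y → label x ≡ label y → label (φ i x) ≡ label (φ j y)) →
    (∀ i {x} → M i ≡ just x → full (φ i x) ≡ true → two (φ i x) ≡ false) →
    (∀ i {x} → M i ≡ just x → two (φ i x) ≡ false → SoleParent M i) →
    (∀ i {x c} → M i ≡ just x → c ∈ V′ i → c ∈ V i) →
    (∀ i {x} → M i ≡ just x → Ranked M (demand (φ i x)) (rank x) (V′ i)) →
    Inv M′ n V′
  inv-map {M} {M′} {n} {V} {V′} inv φ e childrenφ rankφ labelφ fullφ twoφ sub rankedφ = record
    { bounded    = bounded′
    ; labelled   = labelled′
    ; distinct   = distinct′
    ; single     = single′
    ; double     = λ p q t → I.double (arc⁻ p) (arc⁻ q) (arc⁻ t)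
    ; fullSingle = fullSingle′
    ; ranked     = ranked′
    ; below      = below′
    ; disjoint   = disjoint′
    }
    where
      module I = Inv inv
      there′ : ∀ {i x} → M i ≡ just x → M′ i ≡ just (φ i x)
      there′ {i} p = trans (e i) (map-just p)
      back : ∀ {i x′} → M′ i ≡ just x′ → ∃ λ x → M i ≡ just x × x′ ≡ φ i x
      back {i} p = map-just⁻ (M i) (trans (sym (e i)) p)
      arc⁻ : ∀ {p c} → Arc M′ p c → Arc M p c
      arc⁻ {p} (x′ , q , c∈) with back q
      ... | x , q′ , refl = x , q′ , subst (_ ∈_) (childrenφ p q′) c∈
      arc : ∀ {p c} → Arc M p c → Arc M′ p c
      arc {p} (x , q , c∈) = φ p x , there′ q , subst (_ ∈_) (sym (childrenφ p q)) c∈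
      rankIs : ∀ {c r} → RankIs M r c → RankIs M′ r c
      rankIs {c} (y , q , refl) = φ c y , there′ q , rankφ c q
      bounded′ : ∀ {i x} → M′ i ≡ just x → i < n
      bounded′ p with back p
      ... | _ , q , _ = I.bounded q
      labelled′ : ∀ {p x c} → M′ p ≡ just x → c ∈ children x → ∃ λ y → M′ c ≡ just y × label y ≡ label x
      labelled′ {p} {c = c} q c∈ with back q
      ... | x , q′ , refl with I.labelled q′ (subst (c ∈_) (childrenφ p q′) c∈)
      ... | y , q″ , l = φ c y , there′ q″ , labelφ c p q″ q′ l
      distinct′ : ∀ {p x} → M′ p ≡ just x → Unique (children x)
      distinct′ {p} q with back q
      ... | x , q′ , refl = subst Unique (sym (childrenφ p q′)) (I.distinct q′)
      single′ : ∀ {c y} → M′ c ≡ just y → two y ≡ false → SoleParent M′ c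
      single′ {c} q t with back q
      ... | x , q′ , refl = λ p p′ → twoφ c q′ t (arc⁻ p) (arc⁻ p′)
      fullSingle′ : ∀ {c y} → M′ c ≡ just y → full y ≡ true → two y ≡ false
      fullSingle′ {c} q f with back q
      ... | x , q′ , refl = fullφ c q′ f
      ranked′ : ∀ {u x} → M′ u ≡ just x → Ranked M′ (demand x) (rank x) (V′ u)
      ranked′ {u} q with back q
      ... | x , q′ , refl =
        subst (λ r → Ranked M′ (demand (φ u x)) r (V′ u)) (sym (rankφ u q′))
          (ranked-map (λ _ → rankIs) (rankedφ u q′))
      below′ : ∀ {u x c} → M′ u ≡ just x → c ∈ V′ u → Below M′ u c
      below′ {u} q c∈ with back q
      ... | x , q′ , _ = below-map arc (I.below q′ (sub u q′ c∈))
      disjoint′ : ∀ {u v x y c} → M′ u ≡ just x → M′ v ≡ just y → c ∈ V′ u → c ∈ V′ v → u ≡ v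
      disjoint′ {u} {v} p q c∈ c∈′ with back p | back q
      ... | _ , p′ , _ | _ , q′ , _ = I.disjoint p′ q′ (sub u p′ c∈) (sub v q′ c∈′)

  -- A root is in no virtual list, and no path starting elsewhere passes through it, so its removal
  -- affects nothing that the invariant says about the remaining nodes. Its own list lapses, as only
  -- live nodes are constrained.
  inv-remove : ∀ {M M′ n V r} → Inv M n V → PointUpdate M r nothing M′ → NoParent M r → Inv M′ n V
  inv-remove {M} {M′} {n} {V} {r} inv (point at off) np = record
    { bounded    = λ p → I.bounded (proj₂ (back p))
    ; labelled   = labelled′
    ; distinct   = λ p → I.distinct (proj₂ (back p))
    ; single     = λ q t p p′ → I.single (proj₂ (back q)) t (arc⁻ p) (arc⁻ p′)
    ; double     = λ p q t → I.double (arc⁻ p) (arc⁻ q) (arc⁻ t)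
    ; fullSingle = λ p → I.fullSingle (proj₂ (back p))
    ; ranked     = λ p → ranked-map (λ c∈ → rankIs (λ { refl → I.root∉virtual np (proj₂ (back p)) c∈ }))
                                    (I.ranked (proj₂ (back p)))
    ; below      = λ p c∈ → below′ (proj₁ (back p)) (I.below (proj₂ (back p)) c∈)
    ; disjoint   = λ p q → I.disjoint (proj₂ (back p)) (proj₂ (back q))
    }
    where
      module I = Inv inv
      back : ∀ {i x} → M′ i ≡ just x → i ≢ r × M i ≡ just x
      back {i} p with i ≟ r
      ... | no i≢r = i≢r , trans (sym (off i≢r)) p
      ... | yes refl with trans (sym at) p
      ... | ()
      arc⁻ : ∀ {p c} → Arc M′ p c → Arc M p c
      arc⁻ (x , p , c∈) = x , proj₂ (back p) , c∈
      rankIs : ∀ {c s} → c ≢ r → RankIs M s c → RankIs M′ s c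
      rankIs c≢r (y , p , e) = y , trans (off c≢r) p , e
      labelled′ : ∀ {p x c} → M′ p ≡ just x → c ∈ children x → ∃ λ y → M′ c ≡ just y × label y ≡ label x
      labelled′ q c∈ with I.labelled (proj₂ (back q)) c∈
      ... | y , e , l = y , trans (off (λ { refl → np (_ , proj₂ (back q) , c∈) })) e , l
      below′ : ∀ {u c} → u ≢ r → Below M u c → Below M′ u c
      below′ u≢r [ x , p , c∈ ] = [ x , trans (off u≢r) p , c∈ ]
      below′ u≢r (arc@(x , p , c∈) ∷ path) =
        (x , trans (off u≢r) p , c∈) ∷ below′ (λ { refl → np arc }) path

  record SameButChildren (X Y : Node) : Set a where
    constructor same
    field
      full≡  : full Y ≡ full X
      rank≡  : rank Y ≡ rank X
      two≡   : two Y ≡ two X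
      label≡ : label Y ≡ label X

  -- The loser had no parent, so `w` becomes its only one and no bit has to change. Paths are only
  -- added, and `V` stays as it is: an unranked link creates no virtual child.
  inv-link : ∀ {M M′ n V w l W W′ L} → Inv M n V → PointUpdate M w (just W′) M′ →
    M w ≡ just W → M l ≡ just L → label L ≡ label W → NoParent M l →
    children W′ ≡ l ∷ children W → SameButChildren W W′ → Inv M′ n V
  inv-link {M} {M′} {n} {V} {w} {l} {W} {W′} {L} inv (point at off) w≡ l≡ lab np ch
           (same full≡ rank≡ two≡ label≡) = record
    { bounded    = bounded′
    ; labelled   = labelled′
    ; distinct   = distinct′
    ; single     = single′
    ; double     = double′
    ; fullSingle = fullSingle′
    ; ranked     = ranked′
    ; below      = below′
    ; disjoint   = λ p q → I.disjoint (proj₁ (proj₂ (back p))) (proj₁ (proj₂ (back q)))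
    }
    where
      module I = Inv inv
      there′ : ∀ {i x} → M i ≡ just x →
               ∃ λ x′ → M′ i ≡ just x′ × SameButChildren x x′ × (∀ {c} → c ∈ children x → c ∈ children x′)
      there′ {i} {x} p with i ≟ w
      ... | no i≢w = x , trans (off i≢w) p , same refl refl refl refl , id
      ... | yes refl with trans (sym w≡) p
      ... | refl = W′ , at , same full≡ rank≡ two≡ label≡ , λ c∈ → subst (_ ∈_) (sym ch) (there c∈)
      back : ∀ {i x′} → M′ i ≡ just x′ →
             ∃ λ x → M i ≡ just x × SameButChildren x x′ × (i ≡ w × x′ ≡ W′ × x ≡ W ⊎ x′ ≡ x)
      back {i} {x′} p with i ≟ w
      ... | no i≢w = x′ , trans (sym (off i≢w)) p , same refl refl refl refl , inj₂ refl
      ... | yes refl with trans (sym at) p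
      ... | refl = W , w≡ , same full≡ rank≡ two≡ label≡ , inj₁ (refl , refl , refl)
      arc : ∀ {p c} → Arc M p c → Arc M′ p c
      arc (x , p , c∈) with there′ p
      ... | x′ , p′ , _ , incl = x′ , p′ , incl c∈
      arc⁻ : ∀ {p c} → Arc M′ p c → Arc M p c ⊎ (p ≡ w × c ≡ l)
      arc⁻ (x′ , p , c∈) with back p
      ... | x , p′ , _ , inj₂ refl = inj₁ (x , p′ , c∈)
      ... | x , p′ , _ , inj₁ (refl , refl , refl) with subst (_ ∈_) ch c∈
      ...   | here c≡l  = inj₂ (refl , c≡l)
      ...   | there c∈′ = inj₁ (W , p′ , c∈′)
      newParent : ∀ {p} → Arc M′ p l → p ≡ w
      newParent q with arc⁻ q
      ... | inj₁ q′        = ⊥-elim (np q′)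
      ... | inj₂ (p≡w , _) = p≡w
      oldArc : ∀ {p c} → c ≢ l → Arc M′ p c → Arc M p c
      oldArc c≢l q with arc⁻ q
      ... | inj₁ q′        = q′
      ... | inj₂ (_ , c≡l) = ⊥-elim (c≢l c≡l)
      rankIs : ∀ {c r} → RankIs M r c → RankIs M′ r c
      rankIs (y , p , refl) with there′ p
      ... | y′ , p′ , s , _ = y′ , p′ , SameButChildren.rank≡ s
      bounded′ : ∀ {i x} → M′ i ≡ just x → i < n
      bounded′ p with back p
      ... | _ , q , _ = I.bounded q
      labelOf : ∀ {i y k} → M i ≡ just y → label y ≡ k → ∃ λ y′ → M′ i ≡ just y′ × label y′ ≡ k
      labelOf p refl with there′ p
      ... | y′ , p′ , s , _ = y′ , p′ , SameButChildren.label≡ s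
      labelled′ : ∀ {p x c} → M′ p ≡ just x → c ∈ children x → ∃ λ y → M′ c ≡ just y × label y ≡ label x
      labelled′ q c∈ with back q
      ... | x , q′ , _ , inj₂ refl with I.labelled q′ c∈
      ...   | y , e , k = labelOf e k
      labelled′ q c∈ | x , q′ , _ , inj₁ (refl , refl , refl) with subst (_ ∈_) ch c∈
      ...   | here refl = labelOf l≡ (trans lab (sym label≡))
      ...   | there c∈′ with I.labelled q′ c∈′
      ...     | y , e , k = labelOf e (trans k (sym label≡))
      distinct′ : ∀ {p x} → M′ p ≡ just x → Unique (children x)
      distinct′ q with back q
      ... | x , q′ , _ , inj₂ refl = I.distinct q′
      ... | x , q′ , _ , inj₁ (refl , refl , refl) =
        subst Unique (sym ch) (All.tabulate (λ { c∈ refl → np (W , q′ , c∈) }) ∷ I.distinct q′)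
      single′ : ∀ {c y} → M′ c ≡ just y → two y ≡ false → SoleParent M′ c
      single′ {c} q t p p′ with c ≟ l
      ... | yes refl = trans (newParent p) (sym (newParent p′))
      ... | no c≢l with back q
      ...   | x , q′ , s , _ =
        I.single q′ (trans (sym (SameButChildren.two≡ s)) t) (oldArc c≢l p) (oldArc c≢l p′)
      double′ : ∀ {p q t c} → Arc M′ p c → Arc M′ q c → Arc M′ t c → p ≡ q ⊎ q ≡ t ⊎ p ≡ t
      double′ {c = c} p q t with c ≟ l
      ... | yes refl = inj₁ (trans (newParent p) (sym (newParent q)))
      ... | no c≢l   = I.double (oldArc c≢l p) (oldArc c≢l q) (oldArc c≢l t)
      fullSingle′ : ∀ {c y} → M′ c ≡ just y → full y ≡ true → two y ≡ false
      fullSingle′ q f with back q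
      ... | x , q′ , s , _ =
        trans (SameButChildren.two≡ s) (I.fullSingle q′ (trans (sym (SameButChildren.full≡ s)) f))
      ranked′ : ∀ {u x} → M′ u ≡ just x → Ranked M′ (demand x) (rank x) (V u)
      ranked′ q with back q
      ... | x , q′ , same f r _ _ , _ rewrite f | r = ranked-map (λ _ → rankIs) (I.ranked q′)
      below′ : ∀ {u x c} → M′ u ≡ just x → c ∈ V u → Below M′ u c
      below′ q c∈ with back q
      ... | x , q′ , _ = below-map arc (I.below q′ c∈)

  -- The second half of a ranked link, once the arc is present. The loser has the old rank of `w`,
  -- so putting it in front of `V w` completes the list for the next rank. As a root, `w` is in no
  -- list, so no recorded rank of a virtual child becomes wrong.
  inv-incRank : ∀ {M M′ n V w l W} → Inv M n V → PointUpdate M w (just (incRank W)) M′ →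
    M w ≡ just W → full W ≡ true → NoParent M w → Arc M w l → RankIs M (rank W) l →
    (∀ {u x} → M u ≡ just x → l ∉ V u) → Inv M′ n (upd V w (l ∷ V w))
  inv-incRank {M} {M′} {n} {V} {w} {l} {W} inv (point at off) w≡ fullW np w→l rl l∉V = record
    { bounded    = bounded′
    ; labelled   = labelled′
    ; distinct   = distinct′
    ; single     = single′
    ; double     = λ p q t → I.double (arc⁻ p) (arc⁻ q) (arc⁻ t)
    ; fullSingle = fullSingle′
    ; ranked     = ranked′
    ; below      = below′
    ; disjoint   = disjoint′
    }
    where
      module I = Inv inv
      V′ = upd V w (l ∷ V w)
      l≢w : l ≢ w
      l≢w refl = np w→l
      there′ : ∀ {i x} → M i ≡ just x → ∃ λ x′ → M′ i ≡ just x′ × label x′ ≡ label x × children x′ ≡ children x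
      there′ {i} {x} p with i ≟ w
      ... | no i≢w = x , trans (off i≢w) p , refl , refl
      ... | yes refl with trans (sym w≡) p
      ... | refl = incRank W , at , refl , refl
      back : ∀ {i x′} → M′ i ≡ just x′ →
             ∃ λ x → M i ≡ just x × (i ≡ w × x ≡ W × x′ ≡ incRank W ⊎ i ≢ w × x′ ≡ x)
      back {i} {x′} p with i ≟ w
      ... | no i≢w = x′ , trans (sym (off i≢w)) p , inj₂ (i≢w , refl)
      ... | yes refl with trans (sym at) p
      ... | refl = W , w≡ , inj₁ (refl , refl , refl)
      arc : ∀ {p c} → Arc M p c → Arc M′ p c
      arc (x , p , c∈) with there′ p
      ... | x′ , p′ , _ , ch = x′ , p′ , subst (_ ∈_) (sym ch) c∈
      arc⁻ : ∀ {p c} → Arc M′ p c → Arc M p c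
      arc⁻ (x′ , p , c∈) with back p
      ... | x , p′ , inj₁ (refl , refl , refl) = x , p′ , c∈
      ... | x , p′ , inj₂ (_ , refl)           = x , p′ , c∈
      rankIs : ∀ {c r} → c ≢ w → RankIs M r c → RankIs M′ r c
      rankIs c≢w (y , p , e) = y , trans (off c≢w) p , e
      bounded′ : ∀ {i x} → M′ i ≡ just x → i < n
      bounded′ p with back p
      ... | _ , q , _ = I.bounded q
      labelled′ : ∀ {p x c} → M′ p ≡ just x → c ∈ children x → ∃ λ y → M′ c ≡ just y × label y ≡ label x
      labelled′ q c∈ with back q
      ... | x , q′ , inj₁ (refl , refl , refl) with I.labelled q′ c∈
      ...   | y , e , k with there′ e
      ...     | y′ , e′ , k′ , _ = y′ , e′ , trans k′ k
      labelled′ q c∈ | x , q′ , inj₂ (_ , refl) with I.labelled q′ c∈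
      ...   | y , e , k with there′ e
      ...     | y′ , e′ , k′ , _ = y′ , e′ , trans k′ k
      distinct′ : ∀ {p x} → M′ p ≡ just x → Unique (children x)
      distinct′ q with back q
      ... | x , q′ , inj₁ (refl , refl , refl) = I.distinct q′
      ... | x , q′ , inj₂ (_ , refl)           = I.distinct q′
      single′ : ∀ {c y} → M′ c ≡ just y → two y ≡ false → SoleParent M′ c
      single′ q t p p′ with back q
      ... | x , q′ , inj₁ (refl , refl , refl) = I.single q′ t (arc⁻ p) (arc⁻ p′)
      ... | x , q′ , inj₂ (_ , refl)           = I.single q′ t (arc⁻ p) (arc⁻ p′)
      fullSingle′ : ∀ {c y} → M′ c ≡ just y → full y ≡ true → two y ≡ false
      fullSingle′ q f with back q
      ... | x , q′ , inj₁ (refl , refl , refl) = I.fullSingle q′ f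
      ... | x , q′ , inj₂ (_ , refl)           = I.fullSingle q′ f
      rankedOld : ∀ {u x k r} → M u ≡ just x → Ranked M k r (V u) → Ranked M′ k r (V u)
      rankedOld p = ranked-map (λ c∈ → rankIs (λ { refl → I.root∉virtual np p c∈ }))
      ranked′ : ∀ {u x} → M′ u ≡ just x → Ranked M′ (demand x) (rank x) (V′ u)
      ranked′ q with back q
      ... | x , q′ , inj₁ (refl , refl , refl)
        rewrite upd-at V w (l ∷ V w) | fullW = cons (rankIs l≢w rl) (rankedOld q′ (I.fullRanked q′ fullW))
      ... | x , q′ , inj₂ (u≢w , refl)
        rewrite upd-off V w (l ∷ V w) u≢w = rankedOld q′ (I.ranked q′)
      virtual : ∀ {u c} → c ∈ V′ u → c ∈ V u ⊎ (u ≡ w × c ≡ l)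
      virtual {u} c∈ with u ≟ w
      ... | no u≢w = inj₁ (subst (_ ∈_) (upd-off V w (l ∷ V w) u≢w) c∈)
      ... | yes refl with subst (_ ∈_) (upd-at V w (l ∷ V w)) c∈
      ...   | here c≡l  = inj₂ (refl , c≡l)
      ...   | there c∈′ = inj₁ c∈′
      below′ : ∀ {u x c} → M′ u ≡ just x → c ∈ V′ u → Below M′ u c
      below′ q c∈ with back q | virtual c∈
      ... | x , q′ , _ | inj₁ c∈′          = below-map arc (I.below q′ c∈′)
      ... | x , q′ , _ | inj₂ (refl , refl) = [ arc w→l ]
      disjoint′ : ∀ {u v x y c} → M′ u ≡ just x → M′ v ≡ just y → c ∈ V′ u → c ∈ V′ v → u ≡ v
      disjoint′ p q c∈ c∈′ with back p | back q | virtual c∈ | virtual c∈′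
      ... | _ , p′ , _ | _ , q′ , _ | inj₁ i | inj₁ j = I.disjoint p′ q′ i j
      ... | _ , p′ , _ | _ , q′ , _ | inj₁ i | inj₂ (_ , refl) = ⊥-elim (l∉V p′ i)
      ... | _ , p′ , _ | _ , q′ , _ | inj₂ (_ , refl) | inj₁ j = ⊥-elim (l∉V q′ j)
      ... | _ , p′ , _ | _ , q′ , _ | inj₂ (refl , _) | inj₂ (refl , _) = refl

  -- Serves insert, with no children, and decrease-key, whose new node adopts the node just made
  -- hollow. A child has at most one parent beforehand and its bit is already set, so the second arc
  -- violates neither `single` nor `double`. The entries of `l` need not be children of the new
  -- node; a path through a child is enough.
  inv-new : ∀ {M M′ n V X} l → Inv M n V → PointUpdate M n (just X) M′ →
    Unique (children X) → two X ≡ false →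
    (∀ {c} → c ∈ children X → SoleParent M c ×
             ∃ λ y → M c ≡ just y × label y ≡ label X × two y ≡ true) →
    Ranked M (demand X) (rank X) l →
    (∀ {c} → c ∈ l → ∃ λ q → q ∈ children X × Below M q c) →
    (∀ {u x c} → M u ≡ just x → c ∈ V u → c ∉ l) →
    Inv M′ (suc n) (upd V n l) × NoParent M′ n
  inv-new {M} {M′} {n} {V} {X} l inv (point at off) uniq twoX kids rankedX belowX apart = record
    { bounded    = bounded′
    ; labelled   = labelled′
    ; distinct   = distinct′
    ; single     = single′
    ; double     = double′
    ; fullSingle = fullSingle′
    ; ranked     = ranked′
    ; below      = below′
    ; disjoint   = disjoint′
    } , np
    where
      module I = Inv inv
      V′ = upd V n l
      there′ : ∀ {i x} → M i ≡ just x → M′ i ≡ just x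
      there′ p = trans (off (λ { refl → <-irrefl refl (I.bounded p) })) p
      back : ∀ {i x} → M′ i ≡ just x → (i ≡ n × x ≡ X) ⊎ (i ≢ n × M i ≡ just x)
      back {i} p with i ≟ n
      ... | no i≢n   = inj₂ (i≢n , trans (sym (off i≢n)) p)
      ... | yes refl = inj₁ (refl , just-injective (trans (sym p) at))
      arc : ∀ {p c} → Arc M p c → Arc M′ p c
      arc (x , p , c∈) = x , there′ p , c∈
      arc⁻ : ∀ {p c} → Arc M′ p c → Arc M p c ⊎ (p ≡ n × c ∈ children X)
      arc⁻ (x , p , c∈) with back p
      ... | inj₁ (refl , refl) = inj₂ (refl , c∈)
      ... | inj₂ (_ , q)       = inj₁ (x , q , c∈)
      np : NoParent M′ n
      np q with arc⁻ q
      ... | inj₁ q′ = I.fresh-noParent q′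
      ... | inj₂ (_ , n∈) with kids n∈
      ...   | _ , y , e , _ = <-irrefl refl (I.bounded e)
      rankIs : ∀ {c r} → RankIs M r c → RankIs M′ r c
      rankIs (y , p , e) = y , there′ p , e
      bounded′ : ∀ {i x} → M′ i ≡ just x → i < suc n
      bounded′ p with back p
      ... | inj₁ (refl , _) = ≤-refl
      ... | inj₂ (_ , q)    = m<n⇒m<1+n (I.bounded q)
      labelled′ : ∀ {p x c} → M′ p ≡ just x → c ∈ children x → ∃ λ y → M′ c ≡ just y × label y ≡ label x
      labelled′ q c∈ with back q
      ... | inj₁ (_ , refl) with kids c∈
      ...   | _ , y , e , k , _ = y , there′ e , k
      labelled′ q c∈ | inj₂ (_ , q′) with I.labelled q′ c∈
      ...   | y , e , k = y , there′ e , k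
      distinct′ : ∀ {p x} → M′ p ≡ just x → Unique (children x)
      distinct′ q with back q
      ... | inj₁ (_ , refl) = uniq
      ... | inj₂ (_ , q′)   = I.distinct q′
      single′ : ∀ {c y} → M′ c ≡ just y → two y ≡ false → SoleParent M′ c
      single′ q t p p′ with back q
      ... | inj₁ (refl , _) = ⊥-elim (np p)
      ... | inj₂ (_ , q′) = I.single q′ t (old p) (old p′)
        where
          old : ∀ {p} → Arc M′ p _ → Arc M p _
          old r with arc⁻ r
          ... | inj₁ r′ = r′
          ... | inj₂ (_ , c∈) with kids c∈
          ...   | _ , y , e , _ , t′ with trans (sym e) q′
          ...     | refl with trans (sym t) t′
          ...       | ()
      double′ : ∀ {p q t c} → Arc M′ p c → Arc M′ q c → Arc M′ t c → p ≡ q ⊎ q ≡ t ⊎ p ≡ t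
      double′ p q t with arc⁻ p | arc⁻ q | arc⁻ t
      ... | inj₁ p′ | inj₁ q′ | inj₁ t′ = I.double p′ q′ t′
      ... | inj₂ (refl , _)  | inj₂ (refl , _)  | _ = inj₁ refl
      ... | _ | inj₂ (refl , _)  | inj₂ (refl , _) = inj₂ (inj₁ refl)
      ... | inj₂ (refl , _) | _ | inj₂ (refl , _) = inj₂ (inj₂ refl)
      ... | inj₂ (_ , c∈) | inj₁ q′ | inj₁ t′ = inj₂ (inj₁ (proj₁ (kids c∈) q′ t′))
      ... | inj₁ p′ | inj₂ (_ , c∈) | inj₁ t′ = inj₂ (inj₂ (proj₁ (kids c∈) p′ t′))
      ... | inj₁ p′ | inj₁ q′ | inj₂ (_ , c∈) = inj₁ (proj₁ (kids c∈) p′ q′)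
      fullSingle′ : ∀ {c y} → M′ c ≡ just y → full y ≡ true → two y ≡ false
      fullSingle′ q f with back q
      ... | inj₁ (_ , refl) = twoX
      ... | inj₂ (_ , q′)   = I.fullSingle q′ f
      ranked′ : ∀ {u x} → M′ u ≡ just x → Ranked M′ (demand x) (rank x) (V′ u)
      ranked′ q with back q
      ... | inj₁ (refl , refl) rewrite upd-at V n l = ranked-map (λ _ → rankIs) rankedX
      ... | inj₂ (u≢n , q′) rewrite upd-off V n l u≢n = ranked-map (λ _ → rankIs) (I.ranked q′)
      below′ : ∀ {u x c} → M′ u ≡ just x → c ∈ V′ u → Below M′ u c
      below′ q c∈ with back q
      ... | inj₂ (u≢n , q′) rewrite upd-off V n l u≢n = below-map arc (I.below q′ c∈)
      ... | inj₁ (refl , refl) rewrite upd-at V n l with belowX c∈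
      ...   | p , p∈ , path = (X , q , p∈) ∷ below-map arc path
      disjoint′ : ∀ {u v x y c} → M′ u ≡ just x → M′ v ≡ just y → c ∈ V′ u → c ∈ V′ v → u ≡ v
      disjoint′ p q c∈ c∈′ with back p | back q
      ... | inj₁ (refl , _) | inj₁ (refl , _) = refl
      ... | inj₂ (u≢n , p′) | inj₂ (v≢n , q′)
        rewrite upd-off V n l u≢n | upd-off V n l v≢n = I.disjoint p′ q′ c∈ c∈′
      ... | inj₁ (refl , _) | inj₂ (v≢n , q′)
        rewrite upd-at V n l | upd-off V n l v≢n = ⊥-elim (apart q′ c∈′ c∈)
      ... | inj₂ (u≢n , p′) | inj₁ (refl , _)
        rewrite upd-at V n l | upd-off V n l u≢n = ⊥-elim (apart p′ c∈ c∈′)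

  -- Virtual subtrees and the rank bound

  val : (Node → ℕ) → Maybe Node → ℕ
  val f = maybe′ f 0

  total : (Node → ℕ) → NodeMap → ℕ → ℕ
  total f M n = sumTo (λ i → val f (M i)) n

  total-point : ∀ f {M M′ n r v} → PointUpdate M r v M′ → r < n →
                total f M′ n + val f (M r) ≡ total f M n + val f v
  total-point f {M} {M′} {n} {r} (point at off) r<n =
    trans (sumTo-point r n r<n (λ i i≢r → cong (val f) (off i≢r))) (cong (λ v → total f M n + val f v) at)

  inHeap : HeapId → Node → ℕ
  inHeap h x = if label x ≡ᵇ h then 1 else 0

  inHeap-label : ∀ {h} x → label x ≡ h → inHeap h x ≡ 1
  inHeap-label x refl rewrite ≡ᵇ-refl (label x) = refl

  countIn≡total : ∀ M h n → countIn M h n ≡ total (inHeap h) M n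
  countIn≡total M h zero = refl
  countIn≡total M h (suc n) with M n
  ... | nothing = cong (_+ 0) (countIn≡total M h n)
  ... | just x  = cong (_+ inHeap h x) (countIn≡total M h n)

  module _ {M n V} (inv : Inv M n V) where

    private module I = Inv inv

    -- Chains grow at the lower end, so that two chains to the same node can be compared by their
    -- last steps, where `disjoint` yields a common virtual parent.
    data VirtuallyBelow (u : NodeId) : NodeId → Set a where
      self : VirtuallyBelow u u
      step : ∀ {i c} → VirtuallyBelow u i → (∃ λ x → M i ≡ just x) → c ∈ V i → VirtuallyBelow u c

    vb-cons : ∀ {u c i} → (∃ λ x → M u ≡ just x) → c ∈ V u → VirtuallyBelow c i → VirtuallyBelow u i
    vb-cons live c∈ self            = step self live c∈
    vb-cons live c∈ (step p e i∈)   = step (vb-cons live c∈ p) e i∈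

    -- In a forest the ancestors of a node form a chain: common last steps are removed until one of
    -- the two chains is used up.
    vb-linear : ∀ {u v i} → VirtuallyBelow u i → VirtuallyBelow v i → VirtuallyBelow u v ⊎ VirtuallyBelow v u
    vb-linear self q = inj₂ q
    vb-linear p self = inj₁ p
    vb-linear (step p (_ , e) c∈) (step q (_ , e′) c∈′) with I.disjoint e e′ c∈ c∈′
    ... | refl = vb-linear p q

    vb-rank : ∀ {u i x y} → VirtuallyBelow u i → M u ≡ just x → M i ≡ just y → rank y ≤ rank x
    vb-rank self e e′ with trans (sym e) e′
    ... | refl = ≤-refl
    vb-rank (step p (z , e″) c∈) e e′ with ranked-< (I.ranked e″) c∈
    ... | w , e‴ , lt with trans (sym e‴) e′
    ... | refl = ≤-trans (<⇒≤ lt) (vb-rank p e e″)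

    -- A nontrivial chain from `c` to `d` ends with a step from the only virtual parent of `d`,
    -- which is `u`. Then `u` would be virtually below `c`, although `c` has smaller rank.
    vb-sibling : ∀ {u x c d} → M u ≡ just x → c ∈ V u → d ∈ V u → VirtuallyBelow c d → c ≡ d
    vb-sibling e c∈ d∈ self = refl
    vb-sibling e c∈ d∈ (step p (z , e′) d∈′) with I.disjoint e e′ d∈ d∈′
    ... | refl with ranked-< (I.ranked e) c∈
    ... | y , e″ , lt = ⊥-elim (<-irrefl refl (≤-trans lt (vb-rank p e″ e)))

    vb-disjoint : ∀ {u x c d i} → M u ≡ just x → c ∈ V u → d ∈ V u →
                  VirtuallyBelow c i → VirtuallyBelow d i → c ≡ d
    vb-disjoint e c∈ d∈ p q with vb-linear p q
    ... | inj₁ r = vb-sibling e c∈ d∈ r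
    ... | inj₂ r = sym (vb-sibling e d∈ c∈ r)

    below-label : ∀ {u x c} → M u ≡ just x → Below M u c → ∃ λ y → M c ≡ just y × label y ≡ label x
    below-label e [ x , e′ , c∈ ] with trans (sym e) e′
    ... | refl = I.labelled e c∈
    below-label e ((x , e′ , c∈) ∷ path) with trans (sym e) e′
    ... | refl with I.labelled e c∈
    ...   | y , e″ , k with below-label e″ path
    ...     | z , e‴ , k′ = z , e‴ , trans k′ k

    Subtree : NodeId → Node → NodeId → Set a
    Subtree u x i = VirtuallyBelow u i × ∃ λ y → M i ≡ just y × label y ≡ label x

    -- The two highest virtual children have ranks one and two below that of `u`, so both still
    -- admit `k`, and their disjoint subtrees double the count. Using just these two treats full and
    -- hollow nodes alike.
    subtree : ∀ k {u x} → M u ≡ just x → 2 * k ≤ rank x →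
              ∃ λ l → Unique l × All (Subtree u x) l × 2 ^ k ≤ length l
    subtree zero {u} {x} e _ = u ∷ [] , [] ∷ [] , (self , x , e , refl) ∷ [] , ≤-refl
    subtree (suc k) {u} {x} e le
      -- Rewriting `2 * suc k` as `2 + 2 * k` lets the match expose the rank as `suc (suc r)`.
      with rank x in rx | ≤-trans (≤-reflexive (sym (*-suc 2 k))) le
    ... | suc (suc r) | s≤s (s≤s le′) with topTwo
      where
        topTwo : ∃ λ c → ∃ λ d → c ∈ V u × d ∈ V u × RankIs M (suc r) c × RankIs M r d
        topTwo with I.ranked e
        ... | p rewrite rx with full x
        ...   | true  = ranked-topTwo p
        ...   | false = ranked-topTwo p
    ... | c , d , c∈ , d∈ , rc@(y , ec , ry) , rd@(z , ed , rz)
      with subtree k ec (subst (2 * k ≤_) (sym ry) (m≤n⇒m≤1+n le′)) | subtree k ed (subst (2 * k ≤_) (sym rz) le′)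
    ... | l₁ , u₁ , all₁ , len₁ | l₂ , u₂ , all₂ , len₂ =
      l₁ ++ l₂ , UniqueP.++⁺ u₁ u₂ apart , AllP.++⁺ (All.map (lift c∈ ec) all₁) (All.map (lift d∈ ed) all₂) , len
      where
        apart : ∀ {i} → ¬ (i ∈ l₁ × i ∈ l₂)
        apart (i∈₁ , i∈₂) with vb-disjoint e c∈ d∈ (proj₁ (All.lookup all₁ i∈₁)) (proj₁ (All.lookup all₂ i∈₂))
        ... | refl = 1+n≢n (rankIs-functional {M} rc rd)
        lift : ∀ {q w i} → q ∈ V u → M q ≡ just w → Subtree q w i → Subtree u x i
        lift q∈ eq (p , t , et , kt) with below-label e (I.below e q∈)
        ... | w′ , eq′ , k′ with trans (sym eq) eq′
        ... | refl = vb-cons (x , e) q∈ p , t , et , trans kt k′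
        len : 2 ^ suc k ≤ length (l₁ ++ l₂)
        len rewrite length-++ l₁ {l₂} | +-identityʳ (2 ^ k) = +-mono-≤ len₁ len₂

    -- A rank above `1 + 2 * L` is at least `2 * suc L`, so the heap would have at least `2 ^ suc L`
    -- nodes and a logarithm above `L`. The summand 1 is for odd ranks.
    rank-bound : ∀ {h u x} → M u ≡ just x → label x ≡ h →
                 rank x ≤ 1 + 2 * ⌊log₂ total (inHeap h) M n ⌋
    rank-bound {h} {u} {x} e refl = ≮⇒≥ λ lt → <-irrefl refl (bound (suc L) (subst (_≤ rank x) (sym (*-suc 2 L)) lt))
      where
        L = ⌊log₂ total (inHeap h) M n ⌋
        bound : ∀ k → 2 * k ≤ rank x → k ≤ L
        bound k le with subtree k e le
        ... | l , uniq , all , len = subst (_≤ L) (⌊log₂[2^n]⌋≡n k)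
          (⌊log₂⌋-mono-≤ (≤-trans len (length≤sumTo l n uniq (All.map counted all))))
          where
            counted : ∀ {i} → Subtree u x i → i < n × 1 ≤ val (inHeap h) (M i)
            counted (_ , y , ey , ky) rewrite ey = I.bounded ey , ≤-reflexive (sym (inHeap-label y ky))

  -- The potential is total nodeCredit - 2 * total fullRank.
  nodeCredit fullRank : Node → ℕ
  nodeCredit x  = 3 + length (children x)
  fullRank x = if full x then rank x else 0

  -- The lists of all full nodes, concatenated, are free of repetitions and contain live nodes only.
  -- Their total length is the rank sum, and every entry carries a credit of at least 2, the weight
  -- of the rank sum.
  potential-nonnegative : ∀ {M n V} → Inv M n V → 2 * total fullRank M n ≤ total nodeCredit M n
  potential-nonnegative {M} {n} {V} inv = begin
      2 * total fullRank M n       ≡⟨ *-comm 2 (total fullRank M n) ⟩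
      total fullRank M n * 2       ≡⟨ cong (_* 2) (sym (lengths n)) ⟩
      length (virtuals n) * 2      ≤⟨ weighted-length≤sumTo 2 (virtuals n) n (unique n)
                                        (All.tabulate (λ c∈ → credited (source n c∈))) ⟩
      total nodeCredit M n            ∎
    where
      open ≤-Reasoning
      module I = Inv inv
      ofFull : Maybe Node → List NodeId → List NodeId
      ofFull (just x) l = if full x then l else []
      ofFull nothing  l = []
      virtuals : ℕ → List NodeId
      virtuals zero    = []
      virtuals (suc m) = virtuals m ++ ofFull (M m) (V m)
      ofFull-source : ∀ {c} u → c ∈ ofFull (M u) (V u) → ∃ λ x → M u ≡ just x × c ∈ V u
      ofFull-source u c∈ with M u
      ... | just x with full x
      ...   | true = x , refl , c∈
      source : ∀ {c} m → c ∈ virtuals m → ∃ λ u → u < m × ∃ λ x → M u ≡ just x × c ∈ V u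
      source (suc m) c∈ with ∈-++⁻ (virtuals m) c∈
      ... | inj₂ c∈′ = m , ≤-refl , ofFull-source m c∈′
      ... | inj₁ c∈′ with source m c∈′
      ...   | u , u<m , rest = u , m<n⇒m<1+n u<m , rest
      credited : ∀ {c m} → (∃ λ u → u < m × ∃ λ x → M u ≡ just x × c ∈ V u) →
                 c < n × 2 ≤ val nodeCredit (M c)
      credited (u , _ , x , e , c∈) with below-label inv e (I.below e c∈)
      ... | y , e′ , _ rewrite e′ = I.bounded e′ , s≤s (s≤s z≤n)
      unique′ : ∀ m → Unique (ofFull (M m) (V m))
      unique′ m with M m in e
      ... | nothing = []
      ... | just x with full x
      ...   | true  = ranked-unique (I.ranked e)
      ...   | false = []
      unique : ∀ m → Unique (virtuals m)
      unique zero    = []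
      unique (suc m) = UniqueP.++⁺ (unique m) (unique′ m) apart
        where
          apart : ∀ {c} → ¬ (c ∈ virtuals m × c ∈ ofFull (M m) (V m))
          apart (c∈ , c∈′) with source m c∈ | ofFull-source m c∈′
          ... | u , u<m , x , e , i | y , e′ , j = <⇒≢ u<m (I.disjoint e e′ i j)
      length′ : ∀ m → length (ofFull (M m) (V m)) ≡ val fullRank (M m)
      length′ m with M m in e
      ... | nothing = refl
      ... | just x with full x in f
      ...   | true  = ranked-length (I.fullRanked e f)
      ...   | false = refl
      lengths : ∀ m → length (virtuals m) ≡ total fullRank M m
      lengths zero    = refl
      lengths (suc m) = trans (length-++ (virtuals m)) (cong₂ _+_ (lengths m) (length′ m))

  -- Amortized cost

  -- Both directions matter for the roots of other heaps: forwards they stay alive, backwards they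
  -- gain no parent that was not there before.
  Frame : HeapId → NodeMap → NodeMap → Set a
  Frame h M M′ = ∀ i {x} → label x ≢ h → (M i ≡ just x → M′ i ≡ just x) × (M′ i ≡ just x → M i ≡ just x)

  -- c + Φ′ ≤ d + Φ, with the negative parts of the potentials moved across.
  record Amort (n : ℕ) (M M′ : NodeMap) (c d : ℕ) : Set where
    constructor amort
    field
      bound : c + total nodeCredit M′ n + 2 * total fullRank M n ≤ d + total nodeCredit M n + 2 * total fullRank M′ n

  amort-trans : ∀ {n M₁ M₂ M₃ c₁ c₂ d₁ d₂} → Amort n M₁ M₂ c₁ d₁ → Amort n M₂ M₃ c₂ d₂ →
                Amort n M₁ M₃ (c₁ + c₂) (d₁ + d₂)
  amort-trans {n} {M₁} {M₂} {M₃} {c₁} {c₂} {d₁} {d₂} (amort p) (amort q) =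
    amort (+-cancelʳ-≤ (A M₂ + 2 * B M₂) _ _ (begin
      c₁ + c₂ + A M₃ + 2 * B M₁ + (A M₂ + 2 * B M₂)       ≡⟨ left c₁ c₂ (A M₃) (B M₁) (A M₂) (B M₂) ⟩
      (c₁ + A M₂ + 2 * B M₁) + (c₂ + A M₃ + 2 * B M₂)     ≤⟨ +-mono-≤ p q ⟩
      (d₁ + A M₁ + 2 * B M₂) + (d₂ + A M₂ + 2 * B M₃)     ≡⟨ right d₁ d₂ (A M₁) (B M₃) (A M₂) (B M₂) ⟩
      d₁ + d₂ + A M₁ + 2 * B M₃ + (A M₂ + 2 * B M₂)       ∎))
    where
      open ≤-Reasoning
      A B : NodeMap → ℕ
      A M = total nodeCredit M n
      B M = total fullRank M n
      left : ∀ c₁ c₂ a₃ b₁ a₂ b₂ → c₁ + c₂ + a₃ + 2 * b₁ + (a₂ + 2 * b₂) ≡ (c₁ + a₂ + 2 * b₁) + (c₂ + a₃ + 2 * b₂)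
      left = solve-∀
      right : ∀ d₁ d₂ a₁ b₃ a₂ b₂ → (d₁ + a₁ + 2 * b₂) + (d₂ + a₂ + 2 * b₃) ≡ d₁ + d₂ + a₁ + 2 * b₃ + (a₂ + 2 * b₂)
      right = solve-∀

  amort-weaken : ∀ {n M M′ c c′ d d′} → c′ ≤ c → d ≤ d′ → Amort n M M′ c d → Amort n M M′ c′ d′
  amort-weaken le le′ (amort p) =
    amort (≤-trans (+-monoˡ-≤ _ (+-monoˡ-≤ _ le)) (≤-trans p (+-monoˡ-≤ _ (+-monoˡ-≤ _ le′))))

  amort-cancel : ∀ {n M M′ c d} k → Amort n M M′ (k + c) (k + d) → Amort n M M′ c d
  amort-cancel {n} {M} {M′} {c} {d} k (amort p) = amort (+-cancelˡ-≤ k _ _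
      (subst₂ _≤_ (assoc k c (A M′) (2 * B M)) (assoc k d (A M) (2 * B M′)) p))
    where
      A B : NodeMap → ℕ
      A M = total nodeCredit M n
      B M = total fullRank M n
      assoc : ∀ k c x y → k + c + x + y ≡ k + (c + x + y)
      assoc = solve-∀

  amort-point : ∀ {n M M′ r v c d} → PointUpdate M r v M′ → r < n →
    c + val nodeCredit v + 2 * val fullRank (M r) ≤ d + val nodeCredit (M r) + 2 * val fullRank v →
    Amort n M M′ c d
  amort-point {n} {M} {M′} {r} {v} {c} {d} pt r<n cost =
    amort (+-cancelʳ-≤ (credit₀ + 2 * fullRank₁) _ _ (begin
      c + A M′ + 2 * B M + (credit₀ + 2 * fullRank₁)     ≡⟨ rearrange c (A M′) credit₀ (B M) fullRank₁ ⟩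
      c + (A M′ + credit₀) + 2 * (B M + fullRank₁)
        ≡⟨ cong₂ (λ s t → c + s + 2 * t) (total-point nodeCredit {M} {M′} pt r<n) (sym (total-point fullRank {M} {M′} pt r<n)) ⟩
      c + (A M + credit₁) + 2 * (B M′ + fullRank₀)       ≡⟨ rearrange₂ c (A M) credit₁ (B M′) fullRank₀ ⟩
      (c + credit₁ + 2 * fullRank₀) + (A M + 2 * B M′)   ≤⟨ +-monoˡ-≤ (A M + 2 * B M′) cost ⟩
      (d + credit₀ + 2 * fullRank₁) + (A M + 2 * B M′)   ≡⟨ rearrange₃ d (A M) credit₀ (B M′) fullRank₁ ⟩
      d + A M + 2 * B M′ + (credit₀ + 2 * fullRank₁)     ∎))
    where
      open ≤-Reasoning
      A B : NodeMap → ℕ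
      A M = total nodeCredit M n
      B M = total fullRank M n
      credit₀ = val nodeCredit (M r)
      credit₁ = val nodeCredit v
      fullRank₀ = val fullRank (M r)
      fullRank₁ = val fullRank v
      rearrange : ∀ c a′ a₀ b b₁ → c + a′ + 2 * b + (a₀ + 2 * b₁) ≡ c + (a′ + a₀) + 2 * (b + b₁)
      rearrange = solve-∀
      rearrange₂ : ∀ c a a₁ b′ b₀ → c + (a + a₁) + 2 * (b′ + b₀) ≡ (c + a₁ + 2 * b₀) + (a + 2 * b′)
      rearrange₂ = solve-∀
      rearrange₃ : ∀ d a a₀ b′ b₁ → (d + a₀ + 2 * b₁) + (a + 2 * b′) ≡ d + a + 2 * b′ + (a₀ + 2 * b₁)
      rearrange₃ = solve-∀

  amort-new : ∀ {M n V c d} X → Inv M n V → c + nodeCredit X ≤ d + 2 * fullRank X →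
              Amort (suc n) M (upd M n (just X)) c d
  amort-new {M} {n} {c = c} {d} X inv le = amort-point (upd-point M n (just X)) ≤-refl cost
    where
      cost : c + nodeCredit X + 2 * val fullRank (M n) ≤ d + val nodeCredit (M n) + 2 * fullRank X
      cost rewrite Inv.fresh inv | +-identityʳ (c + nodeCredit X) | +-identityʳ d = le

  -- `Amort` compares both maps over one range of ids. The id about to be allocated contributes 0
  -- before the allocation, so the old potential may be read over the shorter range.
  amort-grow : ∀ {M M′ n V c d} → Inv M n V → Amort (suc n) M M′ c d →
    c + total nodeCredit M′ (suc n) + 2 * total fullRank M n ≤ d + total nodeCredit M n + 2 * total fullRank M′ (suc n)
  amort-grow {M} {M′} {n} {c = c} {d} inv (amort p) =
    subst₂ (λ a b → c + total nodeCredit M′ (suc n) + 2 * b ≤ d + a + 2 * total fullRank M′ (suc n))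
      (total-suc nodeCredit) (total-suc fullRank) p
    where
      total-suc : ∀ f → total f M (suc n) ≡ total f M n
      total-suc f rewrite Inv.fresh inv = +-identityʳ _

  -- `shrinks` makes rank bounds obtained in the middle of a deletion refer to the size of the heap
  -- at its start, on which the allowance depends.
  record Phase (h : HeapId) (n : ℕ) (M M′ : NodeMap) (c d : ℕ) : Set a where
    field
      amortized : Amort n M M′ c d
      shrinks   : total (inHeap h) M′ n ≤ total (inHeap h) M n
      frame     : Frame h M M′
  open Phase

  frame-trans : ∀ {h M₁ M₂ M₃} → Frame h M₁ M₂ → Frame h M₂ M₃ → Frame h M₁ M₃
  frame-trans f g i ne = proj₁ (g i ne) ∘ proj₁ (f i ne) , proj₂ (f i ne) ∘ proj₂ (g i ne)

  frame-point : ∀ {h M M′ r v} → PointUpdate M r v M′ → (∀ {x} → M r ≡ just x → label x ≡ h) →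
                (∀ {x} → v ≡ just x → label x ≡ h) → Frame h M M′
  frame-point {r = r} (point at off) old new i ne with i ≟ r
  ... | no i≢r   = trans (off i≢r) , trans (sym (off i≢r))
  ... | yes refl = (λ e → ⊥-elim (ne (old e))) , (λ e → ⊥-elim (ne (new (trans (sym at) e))))

  phase-pay : ∀ {h n M M′ c d} k → Phase h n M M′ c d → Phase h n M M′ (k + c) (k + d)
  phase-pay k p = record
    { amortized = amort-trans (amort {c = k} {d = k} ≤-refl) (amortized p)
    ; shrinks = shrinks p ; frame = frame p }

  phase-refl : ∀ {h n M} → Phase h n M M 0 0
  phase-refl = record { amortized = amort ≤-refl ; shrinks = ≤-refl ; frame = λ _ _ → id , id }

  phase-trans : ∀ {h n M₁ M₂ M₃ c₁ c₂ d₁ d₂} → Phase h n M₁ M₂ c₁ d₁ → Phase h n M₂ M₃ c₂ d₂ →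
                Phase h n M₁ M₃ (c₁ + c₂) (d₁ + d₂)
  phase-trans p q = record
    { amortized = amort-trans (amortized p) (amortized q)
    ; shrinks   = ≤-trans (shrinks q) (shrinks p)
    ; frame     = frame-trans (frame p) (frame q) }

  phase-weaken : ∀ {h n M M′ c c′ d d′} → c′ ≤ c → d ≤ d′ → Phase h n M M′ c d → Phase h n M M′ c′ d′
  phase-weaken le le′ p = record
    { amortized = amort-weaken le le′ (amortized p) ; shrinks = shrinks p ; frame = frame p }

  phase-point : ∀ {h n M M′ r v c d} → PointUpdate M r v M′ → r < n →
    (∀ {x} → M r ≡ just x → label x ≡ h) → (∀ {x} → v ≡ just x → label x ≡ h) →
    val (inHeap h) v ≤ val (inHeap h) (M r) →
    c + val nodeCredit v + 2 * val fullRank (M r) ≤ d + val nodeCredit (M r) + 2 * val fullRank v →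
    Phase h n M M′ c d
  phase-point {h} {n} {M} {M′} {r} {v} {c} {d} pt r<n old new count cost = record
    { amortized = amort-point pt r<n cost
    ; shrinks = +-cancelʳ-≤ (val (inHeap h) (M r)) _ _
        (≤-trans (≤-reflexive (total-point (inHeap h) {M} {M′} pt r<n)) (+-monoʳ-≤ (total (inHeap h) M n) count))
    ; frame = frame-point pt old new
    }

  phase-modify : ∀ {h n M M′ r X Y c d} → PointUpdate M r (just Y) M′ → r < n → M r ≡ just X →
    label X ≡ h → label Y ≡ h →
    c + nodeCredit Y + 2 * fullRank X ≤ d + nodeCredit X + 2 * fullRank Y →
    Phase h n M M′ c d
  phase-modify {h} {X = X} {Y} {c} {d} pt r<n e lX lY cost =
    phase-point pt r<n (λ e′ → trans (cong label (just-injective (trans (sym e′) e))) lX)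
      (λ { refl → lY })
      (subst (λ v → inHeap h Y ≤ val (inHeap h) v) (sym e)
        (≤-reflexive (trans (inHeap-label Y lY) (sym (inHeap-label X lX)))))
      (subst (λ v → c + nodeCredit Y + 2 * val fullRank v ≤ d + val nodeCredit v + 2 * fullRank Y) (sym e) cost)

  -- Roots, and modifications of a single node

  IsRoot : NodeMap → HeapId → NodeId → Set a
  IsRoot M h r = (∃ λ x → M r ≡ just x × label x ≡ h) × NoParent M r

  -- Arcs never join different labels, so a new parent of `r` would carry the label `h′` as well; by
  -- the frame it was already there with the same children.
  isRoot-frame : ∀ {h h′ n M M′ V r} → h′ ≢ h → Inv M′ n V → Frame h M M′ → IsRoot M h′ r → IsRoot M′ h′ r
  isRoot-frame {M = M} {M′} {r = r} ne inv fr ((x , e , refl) , np) = (x , e′ , refl) , np′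
    where
      e′ = proj₁ (fr r ne) e
      np′ : NoParent M′ r
      np′ {q} (p , ep , r∈) with Inv.labelled inv ep r∈
      ... | y , ey , ly with trans (sym ey) e′
      ... | refl = np (p , proj₂ (fr q (λ l → ne (trans ly l))) ep , r∈)

  RootOf : NodeMap → HeapId → Maybe NodeId → Set a
  RootOf M h m = ∀ {r} → m ≡ just r → IsRoot M h r

  inv-modify : ∀ {M M′ n V V′ u U U′} → Inv M n V → PointUpdate M u (just U′) M′ → M u ≡ just U →
    children U′ ≡ children U → rank U′ ≡ rank U → label U′ ≡ label U →
    (full U′ ≡ true → two U′ ≡ false) → (two U′ ≡ false → SoleParent M u) →
    (∀ {i} → i ≢ u → V′ i ≡ V i) → (∀ {c} → c ∈ V′ u → c ∈ V u) →
    Ranked M (demand U′) (rank U) (V′ u) → Inv M′ n V′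
  inv-modify {M} {M′} {n} {V} {V′} {u} {U} {U′} inv (point at off) e ch rk lb fullU twoU V′-off V′-sub rankedU =
    inv-map inv φ φ-map childrenφ rankφ
      (λ i j p q l → trans (labelφ i p) (trans l (sym (labelφ j q)))) fullφ twoφ subφ rankedφ
    where
      module I = Inv inv
      φ : NodeId → Node → Node
      φ i x with i ≟ u
      ... | yes _ = U′
      ... | no  _ = x
      φ-map : ∀ i → M′ i ≡ Maybe.map (φ i) (M i)
      φ-map i with i ≟ u
      ... | yes refl rewrite e = at
      ... | no i≢u with M i | off i≢u
      ...   | nothing | p = p
      ...   | just x  | p = p
      childrenφ : ∀ i {x} → M i ≡ just x → children (φ i x) ≡ children x
      childrenφ i p with i ≟ u
      ... | no _ = refl
      ... | yes refl with trans (sym e) p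
      ...   | refl = ch
      rankφ : ∀ i {x} → M i ≡ just x → rank (φ i x) ≡ rank x
      rankφ i p with i ≟ u
      ... | no _ = refl
      ... | yes refl with trans (sym e) p
      ...   | refl = rk
      labelφ : ∀ i {x} → M i ≡ just x → label (φ i x) ≡ label x
      labelφ i p with i ≟ u
      ... | no _ = refl
      ... | yes refl with trans (sym e) p
      ...   | refl = lb
      fullφ : ∀ i {x} → M i ≡ just x → full (φ i x) ≡ true → two (φ i x) ≡ false
      fullφ i p with i ≟ u
      ... | no _  = I.fullSingle p
      ... | yes _ = fullU
      twoφ : ∀ i {x} → M i ≡ just x → two (φ i x) ≡ false → SoleParent M i
      twoφ i p with i ≟ u
      ... | no _     = I.single p
      ... | yes refl = twoU
      subφ : ∀ i {x c} → M i ≡ just x → c ∈ V′ i → c ∈ V i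
      subφ i {c = c} p with i ≟ u
      ... | no i≢u   = subst (c ∈_) (V′-off i≢u)
      ... | yes refl = V′-sub
      rankedφ : ∀ i {x} → M i ≡ just x → Ranked M (demand (φ i x)) (rank x) (V′ i)
      rankedφ i p with i ≟ u
      ... | no i≢u rewrite V′-off i≢u = I.ranked p
      ... | yes refl with trans (sym e) p
      ...   | refl = rankedU

  arc-modify : ∀ {M M′ u U U′ p c} → PointUpdate M u (just U′) M′ → M u ≡ just U →
               children U′ ≡ children U → Arc M p c → Arc M′ p c
  arc-modify {u = u} {p = p} (point at off) e ch (x , q , c∈) with p ≟ u
  ... | no p≢u = x , trans (off p≢u) q , c∈
  ... | yes refl with trans (sym e) q
  ...   | refl = _ , at , subst (_ ∈_) (sym ch) c∈

  arc-modify⁻ : ∀ {M M′ u U U′ p c} → PointUpdate M u (just U′) M′ → M u ≡ just U →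
                children U′ ≡ children U → Arc M′ p c → Arc M p c
  arc-modify⁻ {u = u} {p = p} (point at off) e ch (x , q , c∈) with p ≟ u
  ... | no p≢u = x , trans (sym (off p≢u)) q , c∈
  ... | yes refl with trans (sym at) q
  ...   | refl = _ , e , subst (_ ∈_) ch c∈

  label-modify : ∀ {M M′ u U U′ h q} → PointUpdate M u (just U′) M′ → M u ≡ just U → label U′ ≡ label U →
                 (∃ λ x → M q ≡ just x × label x ≡ h) → ∃ λ x → M′ q ≡ just x × label x ≡ h
  label-modify {u = u} {q = q} (point at off) e lb (x , p , l) with q ≟ u
  ... | no q≢u = x , trans (off q≢u) p , l
  ... | yes refl with trans (sym e) p
  ...   | refl = _ , at , trans lb l

  isRoot-modify : ∀ {M M′ u U U′ h q} → PointUpdate M u (just U′) M′ → M u ≡ just U →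
    children U′ ≡ children U → label U′ ≡ label U → IsRoot M h q → IsRoot M′ h q
  isRoot-modify pt e ch lb (live , np) = label-modify pt e lb live , np ∘ arc-modify⁻ pt e ch

  isRoot-link : ∀ {M M′ w l W W′ h q} → PointUpdate M w (just W′) M′ → M w ≡ just W →
    children W′ ≡ l ∷ children W → label W′ ≡ label W → q ≢ l → IsRoot M h q → IsRoot M′ h q
  isRoot-link {M} {M′} {w} {l} {q = q} pt@(point at off) e ch lb q≢l (live , np) = label-modify pt e lb live , np′
    where
      np′ : NoParent M′ q
      np′ {p} (x , r , q∈) with p ≟ w
      ... | no p≢w = np (x , trans (sym (off p≢w)) r , q∈)
      ... | yes refl with trans (sym at) r
      ...   | refl with subst (_ ∈_) ch q∈
      ...     | here q≡l  = q≢l q≡l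
      ...     | there q∈′ = np (_ , e , q∈′)

  isRoot-new : ∀ {M M′ n V X h q} → Inv M n V → PointUpdate M n (just X) M′ → q ∉ children X →
               IsRoot M h q → IsRoot M′ h q
  isRoot-new {M} {M′} {n} {q = q} inv (point at off) q∉ ((x , e , l) , np) =
    (x , trans (off (λ { refl → <-irrefl refl (Inv.bounded inv e) })) e , l) , np′
    where
      np′ : NoParent M′ q
      np′ {p} (y , r , q∈) with p ≟ n
      ... | no p≢n = np (y , trans (sym (off p≢n)) r , q∈)
      ... | yes refl with trans (sym at) r
      ...   | refl = q∉ q∈

  -- Phases of a root deletion

  demand-hollow : ∀ {M l} x → Ranked M (demand x) (rank x) l → Ranked M 2 (rank x) l
  demand-hollow x p with full x
  ... | true  = ranked-weaken p
  ... | false = p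

  fullRank≤rank : ∀ x → fullRank x ≤ rank x
  fullRank≤rank x with full x
  ... | true  = ≤-refl
  ... | false = z≤n

  hollowed : Node → Node
  hollowed x = record x { full = false }

  inv-hollow : ∀ {M n V u U} → Inv M n V → M u ≡ just U → Inv (upd M u (just (hollowed U))) n V
  inv-hollow {M} {n} {V} {u} {U} inv e =
    inv-modify inv (upd-point M u _) e refl refl refl (λ ()) (I.single e) (λ _ → refl) id
      (demand-hollow U (I.ranked e))
    where module I = Inv inv

  -- The item takes at most `rank U` out of the rank sum, which has weight 2. This is the only
  -- charge for making a node hollow.
  phase-hollow : ∀ {M n V u U h} → Inv M n V → M u ≡ just U → label U ≡ h →
                 Phase h n M (upd M u (just (hollowed U))) 0 (2 * rank U)
  phase-hollow {M} {u = u} {U} inv e l = phase-modify (upd-point M u _) (Inv.bounded inv e) e l l (begin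
      nodeCredit U + 2 * fullRank U      ≤⟨ +-monoʳ-≤ (nodeCredit U) (*-monoʳ-≤ 2 (fullRank≤rank U)) ⟩
      nodeCredit U + 2 * rank U          ≡⟨ lemma (nodeCredit U) (rank U) ⟩
      2 * rank U + nodeCredit U + 0      ∎)
    where
      open ≤-Reasoning
      lemma : ∀ x y → x + 2 * y ≡ 2 * y + x + 0
      lemma = solve-∀

  -- A child of a node just destroyed: it has at most one parent left if its
  -- bit is set, and none otherwise.
  Orphan : NodeMap → HeapId → NodeId → Set a
  Orphan M h c = ∃ λ y → M c ≡ just y × label y ≡ h ×
                 (two y ≡ true → SoleParent M c) × (two y ≡ false → NoParent M c)

  record Processed (M : NodeMap) (h n : ℕ) (V : NodeId → List NodeId) (cs : List NodeId)
                   (P : NodeMap × List NodeId) : Set a where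
    field
      inv    : Inv (proj₁ P) n V
      phase  : Phase h n M (proj₁ P) 0 0
      arc⁻   : ∀ {p c} → Arc (proj₁ P) p c → Arc M p c
      others : ∀ {c} → c ∉ cs → proj₁ P c ≡ M c
      unique : Unique (proj₂ P)
      roots  : All (IsRoot (proj₁ P) h) (proj₂ P)
      subset : ∀ {c} → c ∈ proj₂ P → c ∈ cs

  -- `processChildren` treats the tail first. The head does not occur in the tail and so is found
  -- unchanged; a set bit may be reset because at most one parent is left, and an unset one means
  -- that the child is a root by now.
  process : ∀ {M h n V} cs → Inv M n V → Unique cs → All (Orphan M h) cs →
            Processed M h n V cs (processChildren M cs)
  process [] inv _ _ = record
    { inv = inv ; phase = phase-refl ; arc⁻ = id ; others = λ _ → refl
    ; unique = [] ; roots = [] ; subset = λ () }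
  process {M} {h} {n} {V} (c ∷ cs) inv (c∉ ∷ uniq) ((y , e , l , twoY , oneY) ∷ orphans)
    with processChildren M cs | process cs inv uniq orphans
  ... | M₁ , R₁ | ih with M₁ c | trans (Processed.others ih (λ c∈ → All.lookup c∉ c∈ refl)) e
  ... | .(just y) | refl with two y in t
  ... | false = record
    { inv = P.inv ; phase = P.phase ; arc⁻ = P.arc⁻ ; others = λ c∉′ → P.others (c∉′ ∘ there)
    ; unique = All.tabulate (λ { c∈ refl → All.lookup c∉ (P.subset c∈) refl }) ∷ P.unique
    ; roots = ((y , trans (P.others (λ c∈ → All.lookup c∉ c∈ refl)) e , l) , oneY refl ∘ P.arc⁻) ∷ P.roots
    ; subset = λ { (here q) → here q ; (there q) → there (P.subset q) } }
    where module P = Processed ih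
  ... | true = record
    { inv = inv-modify P.inv pt at₁ refl refl refl (λ _ → refl) (λ _ p q → twoY refl (P.arc⁻ p) (P.arc⁻ q))
              (λ _ → refl) id (Inv.ranked P.inv at₁)
    ; phase = phase-trans P.phase (phase-modify pt (Inv.bounded P.inv at₁) at₁ l l ≤-refl)
    ; arc⁻ = P.arc⁻ ∘ arc-modify⁻ pt at₁ refl
    ; others = λ c∉′ → trans (PointUpdate.off pt (λ { refl → c∉′ (here refl) })) (P.others (c∉′ ∘ there))
    ; unique = P.unique
    ; roots = All.map (isRoot-modify pt at₁ refl refl) P.roots
    ; subset = there ∘ P.subset }
    where
      module P = Processed ih
      at₁ : M₁ c ≡ just y
      at₁ = trans (P.others (λ c∈ → All.lookup c∉ c∈ refl)) e
      pt = upd-point M₁ c (just (record y { two = false }))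

  -- The credit of the destroyed node covers 1 plus the length of its child list. For a child with
  -- its bit set, `double` leaves at most one parent besides `r`; with the bit unset `r` was the
  -- only parent. The children that become roots differ from the old roots, since they had the
  -- parent `r`.
  kill-preserves : ∀ {M h n V r x} xs ys → Inv M n V → Unique (xs ++ r ∷ ys) → All (IsRoot M h) (xs ++ r ∷ ys) →
    M r ≡ just x → full x ≡ false →
    let P = processChildren (upd M r nothing) (children x) in
    Inv (proj₁ P) n V × Unique (xs ++ ys ++ proj₂ P) × All (IsRoot (proj₁ P) h) (xs ++ ys ++ proj₂ P) ×
    Phase h n M (proj₁ P) (suc (length (children x))) 0
  kill-preserves {M} {h} {n} {V} {r} {x} xs ys inv uniq roots e hollow
    with Unique-resp-↭ (shift r xs ys) uniq | All-resp-↭ (shift r xs ys) roots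
  ... | r∉ ∷ uniq′ | ((x′ , e′ , l) , np) ∷ roots′ with trans (sym e) e′
  ... | refl =
    P.inv
    , subst Unique assoc (UniqueP.++⁺ uniq′ P.unique separate)
    , subst (All _) assoc (AllP.++⁺ (All.zipWith (λ { (r≢q , root) → kept r≢q root }) (r∉ , roots′)) P.roots)
    , subst (λ k → Phase h n M M₁ k 0) (+-identityʳ _) (phase-trans removed P.phase)
    where
      module I = Inv inv
      M₀ = upd M r nothing
      M₁ = proj₁ (processChildren M₀ (children x))
      pt = upd-point M r nothing
      arc₀⁻ : ∀ {p q} → Arc M₀ p q → p ≢ r × Arc M p q
      arc₀⁻ {p} (z , ez , q∈) with p ≟ r
      ... | no p≢r = p≢r , z , trans (sym (PointUpdate.off pt p≢r)) ez , q∈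
      ... | yes refl with trans (sym (PointUpdate.at pt)) ez
      ...   | ()
      orphan : ∀ {q} → q ∈ children x → Orphan M₀ h q
      orphan {q} q∈ with I.labelled e q∈
      ... | y , ey , ly = y , trans (PointUpdate.off pt (λ { refl → np r→q })) ey , trans ly l , twoLeft , oneLeft
        where
          r→q : Arc M r q
          r→q = x , e , q∈
          twoLeft : two y ≡ true → SoleParent M₀ q
          twoLeft _ s t with arc₀⁻ s | arc₀⁻ t
          ... | s≢r , s′ | t≢r , t′ with I.double s′ t′ r→q
          ...   | inj₁ s≡t        = s≡t
          ...   | inj₂ (inj₁ t≡r) = ⊥-elim (t≢r t≡r)
          ...   | inj₂ (inj₂ s≡r) = ⊥-elim (s≢r s≡r)
          oneLeft : two y ≡ false → NoParent M₀ q
          oneLeft t s with arc₀⁻ s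
          ... | s≢r , s′ = s≢r (I.single ey t s′ r→q)
      module P = Processed (process (children x) (inv-remove inv pt np) (I.distinct e) (All.tabulate orphan))
      kept : ∀ {q} → r ≢ q → IsRoot M h q → IsRoot M₁ h q
      kept {q} r≢q ((y , ey , ly) , npq) =
        (y , trans (P.others (λ q∈ → npq (x , e , q∈))) (trans (PointUpdate.off pt (r≢q ∘ sym)) ey) , ly)
        , λ s → npq (proj₂ (arc₀⁻ (P.arc⁻ s)))
      R₁ = proj₂ (processChildren M₀ (children x))
      separate : ∀ {q} → ¬ (q ∈ xs ++ ys × q ∈ R₁)
      separate (q∈ , q∈′) = proj₂ (All.lookup roots′ q∈) (x , e , P.subset q∈′)
      assoc : (xs ++ ys) ++ R₁ ≡ xs ++ ys ++ R₁
      assoc = ++-assoc xs ys R₁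
      removed : Phase h n M M₀ (suc (length (children x))) 0
      removed = phase-point pt (I.bounded e) (λ e″ → trans (cong label (just-injective (trans (sym e″) e))) l)
        (λ ()) z≤n cost
        where
          cost : suc (length (children x)) + 0 + 2 * val fullRank (M r) ≤ val nodeCredit (M r) + 0
          cost rewrite e | hollow | +-identityʳ (length (children x)) | +-identityʳ (length (children x)) =
            s≤s (m≤n+m _ 2)

  destroy : ∀ {M R M′ R′ c h n V} → Destroy M R M′ R′ c → Inv M n V → Unique R → All (IsRoot M h) R →
            Inv M′ n V × Unique R′ × All (IsRoot M′ h) R′ × Phase h n M M′ c 0
  destroy (stop _) inv uniq roots = inv , uniq , roots , phase-refl
  destroy (kill xs r ys x refl e hollow rest) inv uniq roots with kill-preserves xs ys inv uniq roots e hollow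
  ... | inv₁ , uniq₁ , roots₁ , ph₁ with destroy rest inv₁ uniq₁ roots₁
  ... | inv₂ , uniq₂ , roots₂ , ph₂ = inv₂ , uniq₂ , roots₂ , phase-trans ph₁ ph₂

  isRoot-label : ∀ {M h r x} → IsRoot M h r → M r ≡ just x → label x ≡ h
  isRoot-label ((y , e , l) , _) e′ = trans (cong label (just-injective (trans (sym e′) e))) l

  -- The charge 2 is one unit for the link and one for the new arc, as no rank rises to pay for
  -- them.
  link-preserves : ∀ {M M′ w l h n V} → Link M w l M′ → Inv M n V → IsRoot M h w → IsRoot M h l → w ≢ l →
    Inv M′ n V × (∀ {q} → q ≢ l → IsRoot M h q → IsRoot M′ h q) × Phase h n M M′ 1 2
  link-preserves {M} {w = w} {l} (link {W} ew el _ _ _) inv rw rl w≢l =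
    inv-link inv pt ew el (trans (isRoot-label rl el) (sym lw)) (proj₂ rl) refl (same refl refl refl refl)
    , isRoot-link pt ew refl refl
    , phase-modify pt (Inv.bounded inv ew) ew lw lw ≤-refl
    where
      pt = upd-point M w (just (addChild l W))
      lw = isRoot-label rw ew

  -- Handled as a plain link to an intermediate map `M₁`, followed by an increase of rank. The cost
  -- 1 and the new arc are balanced by the increase of the winner's rank, which counts twice because
  -- the winner is full.
  rlink-preserves : ∀ {M M′ w l h n V} → RLink M w l M′ → Inv M n V → IsRoot M h w → IsRoot M h l → w ≢ l →
    (∃ λ V′ → Inv M′ n V′) × (∀ {q} → q ≢ l → IsRoot M h q → IsRoot M′ h q) × Phase h n M M′ 1 0
  rlink-preserves {M} {w = w} {l} {n = n} {V} (rlink {W} {L} ew el fullW _ _ rk) inv rw rl w≢l =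
    (_ , inv-incRank inv₁ pt₂ (PointUpdate.at pt₁) fullW (proj₂ (isRoot-link pt₁ ew refl refl w≢l rw))
           (addChild l W , PointUpdate.at pt₁ , here refl)
           (L , trans (PointUpdate.off pt₁ (w≢l ∘ sym)) el , sym rk)
           l∉V)
    , isRoot-link pt ew refl refl
    , phase-modify pt (Inv.bounded inv ew) ew lw lw cost
    where
      pt₁ = upd-point M w (just (addChild l W))
      pt  = upd-point M w (just (addChild l (incRank W)))
      M₁  = upd M w (just (addChild l W))
      pt₂ : PointUpdate M₁ w (just (incRank (addChild l W))) (upd M w (just (addChild l (incRank W))))
      pt₂ = point (PointUpdate.at pt) (λ i≢w → trans (PointUpdate.off pt i≢w) (sym (PointUpdate.off pt₁ i≢w)))
      lw = isRoot-label rw ew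
      inv₁ : Inv M₁ n V
      inv₁ = inv-link inv pt₁ ew el (trans (isRoot-label rl el) (sym lw)) (proj₂ rl) refl (same refl refl refl refl)
      l∉V : ∀ {u x} → M₁ u ≡ just x → l ∉ V u
      l∉V {u} p with u ≟ w
      ... | yes refl = Inv.root∉virtual inv (proj₂ rl) ew
      ... | no u≢w   = Inv.root∉virtual inv (proj₂ rl) (trans (sym (PointUpdate.off pt₁ u≢w)) p)
      lemma : ∀ x y → 1 + (4 + x) + 2 * y ≡ 3 + x + 2 * (1 + y)
      lemma = solve-∀
      cost : 1 + (4 + length (children W)) + 2 * fullRank W ≤
             3 + length (children W) + 2 * fullRank (addChild l (incRank W))
      cost rewrite fullW = ≤-reflexive (lemma (length (children W)) (rank W))

  rankedLinks : ∀ {M R M′ R′ c h n V} → RankedLinks M R M′ R′ c → Inv M n V → Unique R → All (IsRoot M h) R →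
    ∃ λ V′ → Inv M′ n V′ × Unique R′ × All (IsRoot M′ h) R′ × AllPairs (DistinctRank M′) R′ × Phase h n M M′ c 0
  rankedLinks (stop ranks) inv uniq roots = _ , inv , uniq , roots , ranks , phase-refl
  rankedLinks (step w l Rest perm lk rest) inv uniq roots
    with Unique-resp-↭ perm uniq | All-resp-↭ perm roots
  ... | (w≢l ∷ w∉) ∷ (l∉ ∷ uniq′) | rw ∷ rl ∷ roots′ with rlink-preserves lk inv rw rl w≢l
  ... | (V₁ , inv₁) , keep , ph with
        rankedLinks rest inv₁ (w∉ ∷ uniq′)
          (keep w≢l rw ∷ All.zipWith (λ { (l≢q , root) → keep (l≢q ∘ sym) root }) (l∉ , roots′))
  ... | V₂ , inv₂ , uniq₂ , roots₂ , ranks , ph₂ = V₂ , inv₂ , uniq₂ , roots₂ , ranks , phase-trans ph ph₂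

  unrankedLinks : ∀ {M R M′ res c h n V} → UnrankedLinks M R M′ res c → Inv M n V → Unique R → All (IsRoot M h) R →
    Inv M′ n V × RootOf M′ h res × Phase h n M M′ c (2 * length R)
  unrankedLinks none inv uniq roots = inv , (λ ()) , phase-refl
  unrankedLinks one  inv uniq (root ∷ []) = inv , (λ { refl → root }) , phase-weaken ≤-refl z≤n phase-refl
  unrankedLinks {R = R} (step w l Rest perm lk rest) inv uniq roots
    with Unique-resp-↭ perm uniq | All-resp-↭ perm roots
  ... | (w≢l ∷ w∉) ∷ (l∉ ∷ uniq′) | rw ∷ rl ∷ roots′ with link-preserves lk inv rw rl w≢l
  ... | inv₁ , keep , ph with
        unrankedLinks rest inv₁ (w∉ ∷ uniq′)
          (keep w≢l rw ∷ All.zipWith (λ { (l≢q , root) → keep (l≢q ∘ sym) root }) (l∉ , roots′))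
  ... | inv₂ , root , ph₂ = inv₂ , root , phase-weaken ≤-refl (≤-reflexive count) (phase-trans ph ph₂)
    where
      count : 2 + 2 * suc (length Rest) ≡ 2 * length R
      count rewrite ↭-length perm = sym (*-suc 2 (suc (length Rest)))

  -- Restates the local function of `maxRank`, with the same default 0 at dead ids.
  rankOf : NodeMap → NodeId → ℕ
  rankOf M r = val rank (M r)

  rankOf≤maxRank : ∀ M R → All (λ r → rankOf M r ≤ maxRank M R) R
  rankOf≤maxRank M [] = []
  rankOf≤maxRank M (r ∷ R) with M r in e | rankOf≤maxRank M R
  ... | nothing | ih = subst (λ v → val rank v ≤ maxRank M R) (sym e) z≤n ∷ ih
  ... | just x  | ih = subst (λ v → val rank v ≤ rank x ⊔ maxRank M R) (sym e) (m≤m⊔n (rank x) _)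
                       ∷ All.map (λ le → ≤-trans le (m≤n⊔m (rank x) _)) ih

  maxRank≤ : ∀ M {B} R → All (λ r → rankOf M r ≤ B) R → maxRank M R ≤ B
  maxRank≤ M [] [] = z≤n
  maxRank≤ M (r ∷ R) (le ∷ les) with M r
  ... | nothing = maxRank≤ M R les
  ... | just x  = ⊔-lub le (maxRank≤ M R les)

  -- Pigeonhole: the ranks of the roots are distinct numbers below `suc (maxRank M R)`.
  distinctRanks-length : ∀ {M h} R → All (IsRoot M h) R → AllPairs (DistinctRank M) R → length R ≤ suc (maxRank M R)
  distinctRanks-length {M} {h} R roots ranks = begin
      length R                              ≡⟨ length-map (rankOf M) R ⟨
      length (map (rankOf M) R)             ≤⟨ length≤sumTo (map (rankOf M) R) m (unique R roots ranks)
                                                 (AllP.map⁺ (All.map (λ le → s≤s le , ≤-refl) (rankOf≤maxRank M R))) ⟩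
      sumTo (λ _ → 1) m                     ≡⟨ sumTo-one m ⟩
      m                                     ∎
    where
      open ≤-Reasoning
      m = suc (maxRank M R)
      rankOf≢ : ∀ {p q} → IsRoot M h p → IsRoot M h q → DistinctRank M p q → rankOf M p ≢ rankOf M q
      rankOf≢ ((x , ex , _) , _) ((y , ey , _) , _) ne eq rewrite ex | ey = ne x y refl refl eq
      unique : ∀ R → All (IsRoot M h) R → AllPairs (DistinctRank M) R → Unique (map (rankOf M) R)
      unique [] [] [] = []
      unique (r ∷ R) (root ∷ roots) (ne ∷ ranks) =
        AllP.map⁺ (All.zipWith (λ { (root′ , d) → rankOf≢ root root′ d }) (roots , ne)) ∷ unique R roots ranks

  -- Destruction and ranked links charge nothing. What remains is `2 + m` for the operation and the
  -- scan of the array, twice the rank of the emptied root, and 2 for each root left to the unranked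
  -- links; all of these are governed by the rank bound.
  deleteRoot : ∀ {M r M′ res c h n V} → DeleteRoot M r M′ res c → Inv M n V → IsRoot M h r →
    ∃ λ V′ → Inv M′ n V′ × RootOf M′ h res × Phase h n M M′ c (10 * suc ⌊log₂ total (inHeap h) M n ⌋)
  deleteRoot {M} {r} {M′} {h = h} {n} (del {X} {M₁} {R₁} {c₁} {M₂} {R₂} {c₂} {c₃ = c₃} e des rls uls) inv root
    with destroy des (inv-hollow inv e) ([] ∷ []) (isRoot-modify (upd-point M r _) e refl refl root ∷ [])
  ... | inv₁ , uniq₁ , roots₁ , ph₁ with rankedLinks rls inv₁ uniq₁ roots₁
  ... | V₂ , inv₂ , uniq₂ , roots₂ , ranks , ph₂ with unrankedLinks uls inv₂ uniq₂ roots₂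
  ... | inv₃ , root₃ , ph₃ = V₂ , inv₃ , root₃ , phase-weaken (≤-reflexive (costs c₁ c₂ m c₃)) bound (phase-pay (2 + m) all)
    where
      m = maxRank M₂ R₂
      L = ⌊log₂ total (inHeap h) M n ⌋
      lX = isRoot-label root e
      ph₁₂ = phase-trans (phase-trans (phase-hollow inv e lX) ph₁) ph₂
      all = phase-trans ph₁₂ ph₃
      costs : ∀ c₁ c₂ m c₃ → suc (c₁ + c₂ + suc m + c₃) ≡ 2 + m + (c₁ + c₂ + c₃)
      costs = solve-∀
      rank≤ : ∀ {q} → IsRoot M₂ h q → rankOf M₂ q ≤ 1 + 2 * L
      rank≤ ((x , ex , lx) , _) rewrite ex =
        ≤-trans (rank-bound inv₂ ex lx) (s≤s (*-monoʳ-≤ 2 (⌊log₂⌋-mono-≤ (shrinks ph₁₂))))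
      m≤ : m ≤ 1 + 2 * L
      m≤ = maxRank≤ M₂ R₂ (All.map rank≤ roots₂)
      len≤ : length R₂ ≤ 2 + 2 * L
      len≤ = ≤-trans (distinctRanks-length R₂ roots₂ ranks) (s≤s m≤)
      -- With `m` and the rank of the root at most `1 + 2 * L` and at most `2 + 2 * L` roots left,
      -- the charges add up to `9 + 10 * L`.
      sums : ∀ L → 2 + (1 + 2 * L) + (2 * (1 + 2 * L) + 0 + 0 + 2 * (2 + 2 * L)) + 1 ≡ 10 * suc L
      sums = solve-∀
      bound : 2 + m + (2 * rank X + 0 + 0 + 2 * length R₂) ≤ 10 * suc L
      bound = ≤-trans (+-mono-≤ (+-monoʳ-≤ 2 m≤)
                (+-mono-≤ (+-monoˡ-≤ 0 (+-monoˡ-≤ 0 (*-monoʳ-≤ 2 (rank-bound inv e lX)))) (*-monoʳ-≤ 2 len≤)))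
                (≤-trans (m≤m+n _ 1) (≤-reflexive (sums L)))

  -- Operations

  meldRoots : ∀ {M m₁ m₂ M′ m h n V} → MeldRoots M m₁ m₂ M′ m → Inv M n V → RootOf M h m₁ → RootOf M h m₂ →
    (∀ {r} → m₁ ≡ just r → m₂ ≢ just r) → Inv M′ n V × RootOf M′ h m × Phase h n M M′ 1 2
  meldRoots leftEmpty  inv r₁ r₂ _ = inv , r₂ , phase-pay′
    where phase-pay′ = phase-weaken ≤-refl (s≤s z≤n) (phase-pay 1 phase-refl)
  meldRoots rightEmpty inv r₁ r₂ _ = inv , r₁ , phase-pay′
    where phase-pay′ = phase-weaken ≤-refl (s≤s z≤n) (phase-pay 1 phase-refl)
  meldRoots (linkL lk) inv r₁ r₂ apart with link-preserves lk inv (r₁ refl) (r₂ refl) (λ { refl → apart refl refl })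
  ... | inv′ , keep , ph = inv′ , (λ { refl → keep (λ { refl → apart refl refl }) (r₁ refl) }) , ph
  meldRoots (linkR lk) inv r₁ r₂ apart with link-preserves lk inv (r₂ refl) (r₁ refl) (λ { refl → apart refl refl })
  ... | inv′ , keep , ph = inv′ , (λ { refl → keep (λ { refl → apart refl refl }) (r₂ refl) }) , ph

  Roots : NodeMap → (HeapId → Maybe (Maybe NodeId)) → Set a
  Roots M H = ∀ {h m} → H h ≡ just m → RootOf M h m

  roots-upd : ∀ {M M′ H h m n V} → Roots M H → Inv M′ n V → Frame h M M′ → RootOf M′ h m → Roots M′ (upd H h (just m))
  roots-upd {H = H} {h} {m} roots inv fr root {h′} e with h′ ≟ h
  ... | yes refl with just-injective (trans (sym (upd-at H h (just m))) e)
  ...   | refl = root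
  roots-upd {H = H} {h} {m} roots inv fr root {h′} e | no ne = λ q →
    isRoot-frame ne inv fr (roots (trans (sym (upd-off H h (just m) ne)) e) q)

  WellFormed : State → Set a
  WellFormed s = (∃ λ V → Inv (nodes s) (nextNode s) V) × Roots (nodes s) (heaps s)

  credit debt : State → ℕ
  credit s = total nodeCredit (nodes s) (nextNode s)
  debt s   = 2 * total fullRank (nodes s) (nextNode s)

  Amortized : State → State → ℕ → ℕ → Set a
  Amortized s s′ c d = WellFormed s′ × c + credit s′ + debt s ≤ d + credit s + debt s′

  insert-new : ∀ {M n V k h} → Inv M n V →
    let M′ = upd M n (just (record { full = true ; key = k ; rank = 0 ; children = [] ; two = false ; label = h })) in
    Inv M′ (suc n) (upd V n []) × IsRoot M′ h n
  insert-new {M} {n} {V} inv with inv-new [] inv (upd-point M n _) [] refl (λ ()) nil (λ ()) (λ _ _ ())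
  ... | inv′ , np = inv′ , (_ , upd-at M n _ , refl) , np

  frame-new : ∀ {M n V X} → Inv M n V → Frame (label X) M (upd M n (just X))
  frame-new {M} {n} {V} {X} inv = frame-point (upd-point M n (just X))
    (λ e → ⊥-elim (<-irrefl refl (Inv.bounded inv e))) (λ { refl → refl })

  renamed : HeapId → HeapId → HeapId → HeapId
  renamed h₂ h₁ h = if h ≡ᵇ h₂ then h₁ else h

  relabelNode : HeapId → HeapId → Node → Node
  relabelNode h₂ h₁ x = if label x ≡ᵇ h₂ then record x { label = h₁ } else x

  relabelNode-label : ∀ h₂ h₁ x → label (relabelNode h₂ h₁ x) ≡ renamed h₂ h₁ (label x)
  relabelNode-label h₂ h₁ x with label x ≡ᵇ h₂
  ... | true  = refl
  ... | false = refl

  relabelNode-other : ∀ {b} {B : Set b} (f : Node → B) → (∀ x h → f (record x { label = h }) ≡ f x) →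
                      ∀ h₂ h₁ x → f (relabelNode h₂ h₁ x) ≡ f x
  relabelNode-other f stable h₂ h₁ x with label x ≡ᵇ h₂
  ... | true  = stable x h₁
  ... | false = refl

  relabel-map : ∀ M h₂ h₁ i → relabel M h₂ h₁ i ≡ Maybe.map (relabelNode h₂ h₁) (M i)
  relabel-map M h₂ h₁ i with M i
  ... | nothing = refl
  ... | just x  = refl

  -- Renaming may merge two labels but never separates equal ones, which is all that `inv-map` asks
  -- of labels.
  inv-relabel : ∀ {M n V} h₂ h₁ → Inv M n V → Inv (relabel M h₂ h₁) n V
  inv-relabel {M} h₂ h₁ inv = inv-map inv (λ _ → relabelNode h₂ h₁) (relabel-map M h₂ h₁)
      (λ _ {x} _ → other children (λ _ _ → refl) x) (λ _ {x} _ → other rank (λ _ _ → refl) x)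
      (λ _ _ {x} {y} _ _ l → trans (relabelNode-label h₂ h₁ x)
                               (trans (cong (renamed h₂ h₁) l) (sym (relabelNode-label h₂ h₁ y))))
      (λ _ {x} e f → trans (other two (λ _ _ → refl) x)
                           (I.fullSingle e (trans (sym (other full (λ _ _ → refl) x)) f)))
      (λ _ {x} e t → I.single e (trans (sym (other two (λ _ _ → refl) x)) t))
      (λ _ _ → id)
      (λ i {x} e → subst (λ k → Ranked M k (rank x) _) (sym (other demand (λ _ _ → refl) x)) (I.ranked e))
    where
      module I = Inv inv
      other : ∀ {b} {B : Set b} (f : Node → B) → (∀ x h → f (record x { label = h }) ≡ f x) →
              ∀ x → f (relabelNode h₂ h₁ x) ≡ f x
      other f stable = relabelNode-other f stable h₂ h₁

  isRoot-relabel : ∀ {M h r} h₂ h₁ → IsRoot M h r → IsRoot (relabel M h₂ h₁) (renamed h₂ h₁ h) r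
  isRoot-relabel {M} {r = r} h₂ h₁ ((x , e , refl) , np) =
    (relabelNode h₂ h₁ x , trans (relabel-map M h₂ h₁ r) (map-just e) , relabelNode-label h₂ h₁ x) , np′
    where
      np′ : NoParent (relabel M h₂ h₁) r
      np′ {p} (y , ey , r∈) with map-just⁻ (M p) (trans (sym (relabel-map M h₂ h₁ p)) ey)
      ... | z , ez , refl = np (z , ez , subst (r ∈_) (relabelNode-other children (λ _ _ → refl) h₂ h₁ z) r∈)

  total-relabel : ∀ f → (∀ x h → f (record x { label = h }) ≡ f x) →
                  ∀ M h₂ h₁ n → total f (relabel M h₂ h₁) n ≡ total f M n
  total-relabel f stable M h₂ h₁ n = sumTo-cong n λ i _ → lemma i
    where
      lemma : ∀ i → val f (relabel M h₂ h₁ i) ≡ val f (M i)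
      lemma i with M i
      ... | nothing = refl
      ... | just x  = relabelNode-other f stable h₂ h₁ x

  renamed-same : ∀ h₂ h₁ → renamed h₂ h₁ h₂ ≡ h₁
  renamed-same h₂ h₁ rewrite ≡ᵇ-refl h₂ = refl

  renamed-other : ∀ {h₂ h} h₁ → h ≢ h₂ → renamed h₂ h₁ h ≡ h
  renamed-other h₁ ne rewrite ≢⇒≡ᵇ-false ne = refl

  isRoot-< : ∀ {M h n V r} → Inv M n V → IsRoot M h r → r < n
  isRoot-< inv ((_ , e , _) , _) = Inv.bounded inv e

  insert-amortized : ∀ s {k h m M′ m′} → WellFormed s → heaps s h ≡ just m →
    MeldRoots (upd (nodes s) (nextNode s)
                (just (record { full = true ; key = k ; rank = 0 ; children = [] ; two = false ; label = h })))
              m (just (nextNode s)) M′ m′ →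
    Amortized s (record s { nodes = M′ ; heaps = upd (heaps s) h (just m′) ; nextNode = suc (nextNode s) }) 1 10
  insert-amortized s {k} {h} {m} {M′} ((V , inv) , roots) eh mr
    with insert-new {k = k} {h} inv
  ... | inv₀ , root₀ with meldRoots mr inv₀ (λ e → isRoot-new inv (upd-point (nodes s) (nextNode s) _) (λ ()) (roots eh e))
                          (λ { refl → root₀ }) (λ { e refl → <-irrefl refl (isRoot-< inv (roots eh e)) })
  ... | inv′ , root′ , ph =
    ((_ , inv′) , roots-upd roots inv′ (frame-trans (frame-new inv) (frame ph)) root′)
    -- 3 for the credit of the new node, whose rank is 0, and 2 for the meld.
    , amort-grow inv (amort-weaken ≤-refl (m≤m+n 5 5) (amort-trans (amort-new {c = 0} {d = 3} _ inv ≤-refl) (amortized ph)))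

  -- Three changes in turn: `u` becomes hollow and keeps its two highest virtual children, the new
  -- node `n` adopts `u` and takes over the rest of the list, and the roots are melded.
  decreaseKey-amortized : ∀ s {u k h r U M′ m} → WellFormed s → heaps s h ≡ just (just r) → u ≢ r →
    nodes s u ≡ just U → full U ≡ true → label U ≡ h →
    MeldRoots (upd (upd (nodes s) u (just (record U { full = false ; two = true })))
                   (nextNode s)
                   (just (record { full = true ; key = k ; rank = rank U ∸ 2
                                 ; children = u ∷ [] ; two = false ; label = h })))
              (just r) (just (nextNode s)) M′ m →
    Amortized s (record s { nodes = M′ ; heaps = upd (heaps s) h (just m) ; nextNode = suc (nextNode s) }) 1 10
  decreaseKey-amortized s {u} {k} {h} {r} {U} {M′} ((V , inv) , roots) eh u≢r eu fullU refl mr =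
    conclude (meldRoots mr (proj₁ new) (λ { refl → root₂ }) (λ { refl → (X , upd-at M₁ n _ , refl) , λ {p} → proj₂ new {p} })
               (λ { refl refl → <-irrefl refl (isRoot-< inv (roots eh refl)) }))
    where
      module I = Inv inv
      M = nodes s
      n = nextNode s
      U₁ X : Node
      U₁ = record U { full = false ; two = true }
      X = record { full = true ; key = k ; rank = rank U ∸ 2 ; children = u ∷ [] ; two = false ; label = h }
      M₁ = upd M u (just U₁)
      pt = upd-point M u (just U₁)
      V₁ = upd V u (take 2 (V u))
      rankedU = I.fullRanked eu fullU
      inv₁ : Inv M₁ n V₁
      inv₁ = inv-modify inv pt eu refl refl refl (λ ()) (λ ()) (upd-off V u _)
        (λ c∈ → take2⊆ (V u) (subst (_ ∈_) (upd-at V u _) c∈))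
        (subst (Ranked M 2 (rank U)) (sym (upd-at V u _)) (ranked-take2 rankedU))
      rankIs₁ : ∀ {c q} → RankIs M q c → RankIs M₁ q c
      rankIs₁ {c} (y , e , refl) with c ≟ u
      ... | no c≢u = y , trans (upd-off M u _ c≢u) e , refl
      ... | yes refl with trans (sym e) eu
      ...   | refl = U₁ , upd-at M u _ , refl
      apart : ∀ {v x c} → M₁ v ≡ just x → c ∈ V₁ v → c ∉ drop 2 (V u)
      apart {v} {c = c} e c∈ c∈′ with v ≟ u
      ... | yes refl = take2∩drop2⊆∅ (V u) (ranked-unique rankedU) (subst (c ∈_) (upd-at V u _) c∈) c∈′
      ... | no v≢u = v≢u (I.disjoint (trans (sym (upd-off M u _ v≢u)) e) eu
                           (subst (c ∈_) (upd-off V u _ v≢u) c∈) (drop2⊆ (V u) c∈′))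
      -- While full, `u` had its bit unset and so at most one parent; the new node becomes at most
      -- the second.
      sole : SoleParent M₁ u
      sole p q = I.single eu (I.fullSingle eu fullU) (arc-modify⁻ pt eu refl p) (arc-modify⁻ pt eu refl q)
      new : Inv (upd M₁ n (just X)) (suc n) (upd V₁ n (drop 2 (V u))) × NoParent (upd M₁ n (just X)) n
      new = inv-new (drop 2 (V u)) inv₁ (upd-point M₁ n (just X)) ([] ∷ []) refl
        (λ { (here refl) → sole , U₁ , upd-at M u _ , refl , refl })
        (ranked-map (λ _ → rankIs₁) (ranked-drop2 rankedU))
        (λ c∈ → u , here refl , below-map (arc-modify pt eu refl) (I.below eu (drop2⊆ (V u) c∈)))
        apart
      root₂ : IsRoot (upd M₁ n (just X)) h r
      root₂ = isRoot-new inv₁ (upd-point M₁ n (just X)) (λ { (here refl) → u≢r refl })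
                (isRoot-modify pt eu refl refl (roots eh refl))
      hollow : Phase h (suc n) M M₁ 0 (2 * rank U)
      hollow = phase-modify pt (m<n⇒m<1+n (I.bounded eu)) eu refl refl
        (≤-trans (+-monoʳ-≤ (nodeCredit U) (*-monoʳ-≤ 2 (fullRank≤rank U)))
                 (≤-reflexive (lemma (nodeCredit U) (rank U))))
        where
          lemma : ∀ x y → x + 2 * y ≡ 2 * y + x + 0
          lemma = solve-∀
      conclude : ∀ {M′ m} → Inv M′ (suc n) (upd V₁ n (drop 2 (V u))) × RootOf M′ h m × Phase h (suc n) (upd M₁ n (just X)) M′ 1 2 →
        Amortized s (record s { nodes = M′ ; heaps = upd (heaps s) h (just m) ; nextNode = suc (nextNode s) }) 1 10
      conclude {M′} {m} (inv′ , root′ , ph) =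
        ((_ , inv′) , roots-upd roots inv′ (frame-trans (frame hollow) (frame-trans (frame-new inv₁) (frame ph))) root′)
        -- Creating the full node `X` gives back `2 * rank X` of the `2 * rank U` charged for `u`.
        -- It is entered as a cost, then cancelled; the difference is at most 4 since `rank X` is
        -- `rank U ∸ 2`.
        , amort-grow inv (amort-cancel (2 * rank X) (amort-weaken ≤-refl enough
            (amort-trans (amort-trans (amortized hollow) (amort-new X inv₁ (≤-reflexive (+-comm (2 * rank X) 4))))
                         (amortized ph))))
        where
          lemma : ∀ x → 2 * (2 + x) + 4 + 2 ≡ 2 * x + 10
          lemma = solve-∀
          enough : 2 * rank U + 4 + 2 ≤ 2 * rank X + 10
          enough = ≤-trans (+-monoˡ-≤ 2 (+-monoˡ-≤ 4 (*-monoʳ-≤ 2 (m≤n+m∸n (rank U) 2))))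
                           (≤-reflexive (lemma (rank U ∸ 2)))

  -- Credits and ranks do not depend on labels, so renaming is free in the potential. The two roots
  -- are distinct because their labels were.
  meld-amortized : ∀ s {h₁ h₂ m₁ m₂ M′ m} → WellFormed s → h₁ ≢ h₂ →
    heaps s h₁ ≡ just m₁ → heaps s h₂ ≡ just m₂ → MeldRoots (relabel (nodes s) h₂ h₁) m₁ m₂ M′ m →
    Amortized s (record s { nodes = M′ ; heaps = upd (upd (heaps s) h₂ nothing) h₁ (just m) }) 1 10
  meld-amortized s {h₁} {h₂} {M′ = M′} ((V , inv) , roots) ne e₁ e₂ mr
    with meldRoots mr (inv-relabel h₂ h₁ inv)
           (λ e → subst (λ h → IsRoot (relabel (nodes s) h₂ h₁) h _) (renamed-other h₁ ne) (isRoot-relabel h₂ h₁ (roots e₁ e)))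
           (λ e → subst (λ h → IsRoot (relabel (nodes s) h₂ h₁) h _) (renamed-same h₂ h₁) (isRoot-relabel h₂ h₁ (roots e₂ e)))
           (λ e e′ → ne (trans (sym (isRoot-label (roots e₁ e) (proj₁ (proj₂ (proj₁ (roots e₂ e′))))))
                               (proj₂ (proj₂ (proj₁ (roots e₂ e′))))))
  ... | inv′ , root′ , ph =
    ((_ , inv′) , roots-upd roots′ inv′ (frame ph) root′)
    , subst₂ (λ a b → 1 + total nodeCredit M′ (nextNode s) + 2 * b ≤ 10 + a + 2 * total fullRank M′ (nextNode s))
        (total-relabel nodeCredit (λ _ _ → refl) (nodes s) h₂ h₁ (nextNode s))
        (total-relabel fullRank (λ _ _ → refl) (nodes s) h₂ h₁ (nextNode s))
        (Amort.bound (amort-weaken ≤-refl (m≤m+n 2 8) (amortized ph)))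
    where
      roots′ : Roots (relabel (nodes s) h₂ h₁) (upd (heaps s) h₂ nothing)
      roots′ {h} e q with h ≟ h₂
      ... | no h≢h₂ = subst (λ h → IsRoot (relabel (nodes s) h₂ h₁) h _) (renamed-other h₁ h≢h₂)
                        (isRoot-relabel h₂ h₁ (roots (trans (sym (upd-off (heaps s) h₂ nothing h≢h₂)) e) q))
      ... | yes refl with trans (sym (upd-at (heaps s) h₂ nothing)) e
      ...   | ()

  deleteRoot-amortized : ∀ s {h r M′ res c} → WellFormed s → heaps s h ≡ just (just r) →
    DeleteRoot (nodes s) r M′ res c →
    Amortized s (record s { nodes = M′ ; heaps = upd (heaps s) h (just res) }) c (10 * suc ⌊log₂ size s h ⌋)
  deleteRoot-amortized s {h} ((V , inv) , roots) eh dr with deleteRoot dr inv (roots eh refl)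
  ... | V′ , inv′ , root′ , ph rewrite countIn≡total (nodes s) h (nextNode s) =
    ((V′ , inv′) , roots-upd roots inv′ (frame ph) root′) , Amort.bound (amortized ph)

  idle : ∀ {n M} → Amort n M M 1 10
  idle = amort-weaken ≤-refl (m≤m+n 1 9) (amort {c = 1} {d = 1} ≤-refl)

  step-amortized : ∀ {s o s′ c} → WellFormed s → Step s o s′ c → Amortized s s′ c (10 * allowance s o)
  step-amortized {s} ((V , inv) , roots) makeHeapS =
    ((V , inv) , roots-upd roots inv (λ _ _ → id , id) (λ ())) , Amort.bound (idle {nextNode s} {nodes s})
  step-amortized {s} wf (findMinS _) = wf , Amort.bound (idle {nextNode s} {nodes s})
  step-amortized {s} wf (insertS eh mr) = insert-amortized s wf eh mr
  step-amortized {s} wf (meldS ne e₁ e₂ mr) = meld-amortized s wf ne e₁ e₂ mr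
  step-amortized {s} ((V , inv) , roots) (decreaseKeyRootS {u} eh eu fullU lU _) =
    ((V , inv-modify inv pt eu refl refl refl (λ _ → I.fullSingle eu fullU) (I.single eu) (λ _ → refl) id (I.ranked eu))
      , λ e q → isRoot-modify pt eu refl refl (roots e q))
    , Amort.bound (amort-weaken ≤-refl (m≤m+n 1 9) (amortized (phase-modify {c = 1} {d = 1} pt (I.bounded eu) eu lU lU ≤-refl)))
    where
      module I = Inv inv
      pt = upd-point (nodes s) u _
  step-amortized {s} wf (decreaseKeyS eh u≢r eu fullU lU _ mr) = decreaseKey-amortized s wf eh u≢r eu fullU lU mr
  -- Deleting an item below the root takes unit time; the logarithmic allowance pays for the rank
  -- that leaves the rank sum.
  step-amortized {s} ((V , inv) , roots) (deleteS {u} {h} {r} {U} eh u≢r eu fullU lU) =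
    ((V , inv-hollow inv eu) , λ e q → isRoot-modify (upd-point (nodes s) u _) eu refl refl (roots e q))
    , Amort.bound (amort-weaken ≤-refl enough (amortized (phase-pay 1 (phase-hollow inv eu lU))))
    where
      L = ⌊log₂ size s h ⌋
      rank≤ : rank U ≤ 1 + 2 * L
      rank≤ rewrite countIn≡total (nodes s) h (nextNode s) = rank-bound inv eu lU
      lemma : ∀ L → 1 + 2 * (1 + 2 * L) + (7 + 6 * L) ≡ 10 * suc L
      lemma = solve-∀
      enough : 1 + 2 * rank U ≤ 10 * suc L
      enough = ≤-trans (+-monoʳ-≤ 1 (*-monoʳ-≤ 2 rank≤)) (≤-trans (m≤m+n _ (7 + 6 * L)) (≤-reflexive (lemma L)))
  step-amortized {s} wf (deleteRootS eh _ _ _ dr) = deleteRoot-amortized s wf eh dr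
  step-amortized {s} wf (deleteMinS eh dr) = deleteRoot-amortized s wf eh dr

  -- Whole executions

  exec-bound : ∀ {s C A} → WellFormed s → Exec s C A → C + debt s ≤ 10 * A + credit s
  exec-bound ((_ , inv) , _) done = potential-nonnegative inv
  -- The potentials of intermediate states telescope; that of the last state is dropped, being
  -- nonnegative.
  exec-bound {s} wf (step {o = o} {s′} {c} {C} {A} st rest) with step-amortized wf st
  ... | wf′ , le = +-cancelʳ-≤ (credit s′ + debt s′) _ _ (begin
      c + C + debt s + (credit s′ + debt s′)          ≡⟨ left c C (debt s) (credit s′) (debt s′) ⟩
      (c + credit s′ + debt s) + (C + debt s′)        ≤⟨ +-mono-≤ le (exec-bound wf′ rest) ⟩
      (10 * w + credit s + debt s′) + (10 * A + credit s′)
                                                      ≡⟨ right w A (credit s) (debt s′) (credit s′) ⟩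
      10 * (w + A) + credit s + (credit s′ + debt s′) ∎)
    where
      open ≤-Reasoning
      w = allowance s o
      left : ∀ c C b a′ b′ → c + C + b + (a′ + b′) ≡ (c + a′ + b) + (C + b′)
      left = solve-∀
      right : ∀ w A a b′ a′ → (10 * w + a + b′) + (10 * A + a′) ≡ 10 * (w + A) + a + (a′ + b′)
      right = solve-∀

  initial-wellFormed : WellFormed initial
  initial-wellFormed = ((λ _ → []) , record
    { bounded = λ () ; labelled = λ () ; distinct = λ () ; single = λ () ; double = λ { (_ , () , _) }
    ; fullSingle = λ () ; ranked = λ () ; below = λ () ; disjoint = λ () }) , λ ()

theorem4p8 : ∀ {a ℓ₁ ℓ₂} (O : TotalOrder a ℓ₁ ℓ₂) →
    ∃ λ (c : ℕ) → ∀ {C A} → HollowHeap.Exec O (HollowHeap.initial O) C A → C ≤ c * A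
theorem4p8 O = 10 , λ {C} {A} exec →
  -- The initial state has no nodes, so its credit and its debt both compute to 0.
  subst₂ _≤_ (+-identityʳ C) (+-identityʳ (10 * A)) (exec-bound initial-wellFormed exec)
  where open Analysis O
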